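{- If for some $\varepsilon>0$ there is an algorithm that can distinguish between diameter $2$ and $3$ in an undirected unweighted $n$-node graph of treewidth $k$ in $2^{o(k)}\cdot n^{2-\varepsilon}$ time, then the Orthogonal Vectors Conjecture is false. If for some $\varepsilon>0$ there is an algorithm that can distinguish between radius $2$ and $3$ in an undirected unweighted $n$-node graph of treewidth $k$ in $2^{o(k)}\cdot n^{2-\varepsilon}$ time, then the Hitting Set Conjecture is false.
   Context: For an undirected graph $G=(V,E)$ with shortest path distance $d$, the diameter is $\max_{u,v\in V}d(u,v)$ and the radius is $\min_{x\in V}\max_{v\in V} d(x,v)$. Running times are in the standard word-RAM model with $O(\log n)$-bit words. Orthogonal Vectors (OV) Conjecture: there is no $\varepsilon>0$ such that for all $c\ge 1$ there is an algorithm that, given two lists $A,B\subseteq\{0,1\}^d$ of $n$ boolean vectors with $d=c\log n$, determines in $O(n^{2-\varepsilon})$ time whether there is an orthogonal pair $a\in A$, $b\in B$. Hitting Set (HS) Conjecture: there is no $\varepsilon>0$ such that for all $c\ge 1$ there is an algorithm that, given two lists of $n$ subsets of a universe $U$ of size $c\log n$, decides in $O(n^{2-\varepsilon})$ time whether there is a set in the first list that intersects every set in the second list. -}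

module Defs where

open import Data.Bool.Base using (Bool; true; false; if_then_else_; _∧_; _∨_; _xor_)
open import Data.Fin.Base using (Fin; toℕ)
import Data.Fin.Base as Fin
open import Data.Fin.Subset using (Subset; Nonempty; ∣_∣; _∩_)
import Data.Fin.Subset as Subset
open import Data.Integer.Base using () renaming (∣_∣ to abs)
open import Data.List.Base using (List; []; _∷_; _++_; length; map; concatMap)
open import Data.List.Membership.Propositional using (_∈_)
open import Data.List.Relation.Unary.All using (All)
open import Data.List.Relation.Unary.Linked using (Linked)
open import Data.List.Relation.Unary.Unique.Propositional using (Unique)
open import Data.Maybe.Base using (Maybe; just; nothing; _>>=_)
import Data.Maybe.Base as Maybe
open import Data.Nat.Base using (ℕ; zero; suc; _+_; _*_; _∸_; _^_; _≤_; _≡ᵇ_; _<ᵇ_; ⌊_/2⌋; NonZero; _/_; _%_)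
open import Data.Nat.Logarithm using (⌈log₂_⌉)
open import Data.Nat.Properties using (m^n≢0)
open import Data.Product.Base using (Σ; Σ-syntax; ∃; ∃-syntax; ∃₂; _×_; _,_)
open import Data.Rational.Base using (ℚ; ↥_; ↧ₙ_; Positive)
open import Data.Sum.Base using (_⊎_)
open import Data.Vec.Base using (Vec; concat; toList; zipWith; sum)
import Data.Vec.Base as Vec
import Data.Vec.Relation.Unary.All as VecAll
import Data.Vec.Relation.Unary.Any as VecAny
open import Relation.Binary.Construct.Closure.ReflexiveTransitive using (Star; fold)
open import Relation.Binary.PropositionalEquality.Core using (_≡_)
open import Relation.Nullary.Negation.Core using (¬_)

------------------------------------------------------------------------
-- Word RAM
--
-- Programs are structured (while-programs) over registers and a
-- random-access memory; a program with arbitrary jumps becomes a single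
-- loop that dispatches on a program counter, at constant-factor cost.
-- Every instruction and every test of a condition takes one step.

bit : Bool → ℕ
bit b = if b then 1 else 0

data Op : Set where
  add sub mul quot rem and or xor shl shr eq lt : Op

-- Applies f to the binary digits of x and y; f false false must be false.
-- The sum x + y bounds the number of digits.
bitwise : (Bool → Bool → Bool) → ℕ → ℕ → ℕ
bitwise f x y = go (x + y) x y
  where
  odd : ℕ → Bool
  odd a = a % 2 ≡ᵇ 1

  go : ℕ → ℕ → ℕ → ℕ
  go zero    a b = 0
  go (suc k) a b = bit (f (odd a) (odd b)) + 2 * go k ⌊ a /2⌋ ⌊ b /2⌋

-- Subtraction is truncated; dividing by zero gives quotient and
-- remainder 0.
evalOp : Op → ℕ → ℕ → ℕ
evalOp add  x y       = x + y
evalOp sub  x y       = x ∸ y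
evalOp mul  x y       = x * y
evalOp quot x zero    = 0
evalOp quot x (suc y) = x / suc y
evalOp rem  x zero    = 0
evalOp rem  x (suc y) = x % suc y
evalOp and  x y       = bitwise _∧_ x y
evalOp or   x y       = bitwise _∨_ x y
evalOp xor  x y       = bitwise _xor_ x y
evalOp shl  x y       = x * 2 ^ y
evalOp shr  x y       = _/_ x (2 ^ y) {{m^n≢0 2 y}}
evalOp eq   x y       = bit (x ≡ᵇ y)
evalOp lt   x y       = bit (x <ᵇ y)

-- Arguments are register names, except the second one of set.
data Instr : Set where
  set       : ℕ → ℕ → Instr                        -- r ≔ constant
  op        : Op → ℕ → ℕ → ℕ → Instr               -- r ≔ s ∙ s′
  load      : ℕ → ℕ → Instr                        -- r ≔ mem[s]
  store     : ℕ → ℕ → Instr                        -- mem[r] ≔ s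
  ifNonzero : ℕ → List Instr → List Instr → Instr
  while     : ℕ → List Instr → Instr               -- while r ≠ 0

Program : Set
Program = List Instr

record State : Set where
  constructor state
  field
    reg : ℕ → ℕ
    mem : ℕ → ℕ

open State public

_[_↦_] : (ℕ → ℕ) → ℕ → ℕ → (ℕ → ℕ)
(f [ a ↦ v ]) b = if a ≡ᵇ b then v else f b

-- The instructions still to be executed, and the current state.
Config : Set
Config = Program × State

-- Words have w bits.  An instruction whose result does not fit in a word
-- crashes the machine (nothing); arithmetic modulo 2 ^ w can be programmed
-- with words a constant factor longer.
assign : ℕ → ℕ → ℕ → State → Maybe State
assign w r v (state ρ μ) =
  if v <ᵇ 2 ^ w then just (state (ρ [ r ↦ v ]) μ) else nothing

-- A halted machine (no instructions left) stays halted.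
step : ℕ → Config → Maybe Config
step w ([] , σ)                  = just ([] , σ)
step w (set r v ∷ p , σ)         = Maybe.map (p ,_) (assign w r v σ)
step w (op o r s s′ ∷ p , σ)     = Maybe.map (p ,_) (assign w r (evalOp o (reg σ s) (reg σ s′)) σ)
step w (load r s ∷ p , σ)        = Maybe.map (p ,_) (assign w r (mem σ (reg σ s)) σ)
step w (store r s ∷ p , σ)       = just (p , state (reg σ) (mem σ [ reg σ r ↦ reg σ s ]))
step w (ifNonzero r p₁ p₂ ∷ p , σ) with reg σ r
... | zero  = just (p₂ ++ p , σ)
... | suc _ = just (p₁ ++ p , σ)
step w (while r p₁ ∷ p , σ) with reg σ r
... | zero  = just (p , σ)
... | suc _ = just (p₁ ++ while r p₁ ∷ p , σ)

run : ℕ → ℕ → Config → Maybe Config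
run w zero    c = just c
run w (suc t) c = step w c >>= run w t

cells : List ℕ → ℕ → ℕ
cells []       _       = 0
cells (x ∷ xs) zero    = x
cells (x ∷ xs) (suc a) = cells xs a

-- The input occupies the first memory cells; everything else is 0.
initial : List ℕ → State
initial xs = state (λ _ → 0) (cells xs)

-- From input xs, with w-bit words, p halts within t steps and leaves the
-- answer v in register 0.
Outputs : ℕ → Program → List ℕ → ℕ → ℕ → Set
Outputs w p xs t v =
  ∃[ σ ] run w t (p , initial xs) ≡ just ([] , σ) × reg σ 0 ≡ v

------------------------------------------------------------------------
-- Algorithms and running times

-- A promise problem: the input is promised to satisfy Yes or No.
-- The parameter n governing word size and running time is size.
record Problem : Set₁ where
  field
    Instance : Set
    size     : Instance → ℕ
    encode   : Instance → List ℕ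
    Yes No   : Instance → Set

-- Words have O(log n) bits, the constant factor κ being chosen together
-- with the program.  Bound I t says that t steps are allowed on I.
SolvableWithin : (P : Problem) → (Problem.Instance P → ℕ → Set) → Set
SolvableWithin P Bound =
  Σ[ p ∈ Program ] Σ[ κ ∈ ℕ ] ∀ (I : Instance) →
    let w = κ * suc ⌈log₂ size I ⌉ in
    (Yes I → ∃[ t ] Bound I t × Outputs w p (encode I) t 1) ×
    (No  I → ∃[ t ] Bound I t × Outputs w p (encode I) t 0)
  where open Problem P

-- t ≤ K · n^(2-ε), with both sides multiplied by n^ε and raised to the
-- power of the denominator of ε.
-- Rational ε suffice: for n ≥ 1 the bound weakens as ε decreases.
_≤_·_^[2-_] : ℕ → ℕ → ℕ → ℚ → Set
t ≤ K · n ^[2- ε ] =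
  t ^ ↧ₙ ε * n ^ abs (↥ ε) ≤ K ^ ↧ₙ ε * n ^ (2 * ↧ₙ ε)

-- f(k) = o(k): for every m, f(k) ≤ k / m for all large k.
LittleO : (ℕ → ℕ) → Set
LittleO f = ∀ m → ∃[ k₀ ] ∀ k → k₀ ≤ k → m * f k ≤ k

------------------------------------------------------------------------
-- Graphs

-- A finite simple undirected graph: an edge {u , v} is listed exactly
-- once, as the pair with its smaller endpoint first.
record Graph (n : ℕ) : Set where
  field
    edges   : List (Fin n × Fin n)
    ordered : All (λ (u , v) → u Fin.< v) edges
    unique  : Unique edges

open Graph public

module _ {n : ℕ} (G : Graph n) where

  Adj : Fin n → Fin n → Set
  Adj u v = (u , v) ∈ edges G ⊎ (v , u) ∈ edges G

  Walk : Fin n → Fin n → Set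
  Walk = Star Adj

  walkLength : ∀ {u v} → Walk u v → ℕ
  walkLength = fold (λ _ _ → ℕ) (λ _ → suc) 0

  -- The next four are relations rather than functions: a distance,
  -- eccentricity, diameter or radius that is infinite has no value.

  Distance : Fin n → Fin n → ℕ → Set
  Distance u v d =
    (Σ[ p ∈ Walk u v ] walkLength p ≡ d) ×
    (∀ (p : Walk u v) → d ≤ walkLength p)

  Eccentricity : Fin n → ℕ → Set
  Eccentricity x e =
    (∃[ v ] Distance x v e) ×
    (∀ v → ∃[ d ] Distance x v d × d ≤ e)

  Diameter : ℕ → Set
  Diameter D =
    (∃₂ λ u v → Distance u v D) ×
    (∀ u v → ∃[ d ] Distance u v d × d ≤ D)

  Radius : ℕ → Set
  Radius r =
    (∃[ x ] Eccentricity x r) ×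
    (∀ x e → Eccentricity x e → r ≤ e)

  Connected : Set
  Connected = ∀ u v → Walk u v

  -- A cycle: at least three distinct vertices, cyclically adjacent.
  HasCycle : Set
  HasCycle = ∃[ u ] ∃[ v ] ∃[ w ] ∃[ vs ]
    Unique (u ∷ v ∷ w ∷ vs) ×
    Linked Adj (u ∷ v ∷ w ∷ vs ++ u ∷ [])

  IsTree : Set
  IsTree = Connected × ¬ HasCycle

record TreeDecomposition {n : ℕ} (G : Graph n) : Set where
  field
    {nodes}     : ℕ
    tree        : Graph nodes
    isTree      : IsTree tree
    bag         : Fin nodes → Subset n
    coverVertex : ∀ v → ∃[ s ] v Subset.∈ bag s
    coverEdge   : ∀ u v → Adj G u v → ∃[ s ] u Subset.∈ bag s × v Subset.∈ bag s

  -- The bags containing v span a connected part of the tree.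
  field
    connected   : ∀ v s t → v Subset.∈ bag s → v Subset.∈ bag t →
                  Star (λ a b → Adj tree a b × v Subset.∈ bag a × v Subset.∈ bag b) s t

  -- k is the maximum size of a bag, minus one.
  Width : ℕ → Set
  Width k = (∃[ s ] ∣ bag s ∣ ≡ suc k) × (∀ s → ∣ bag s ∣ ≤ suc k)

Treewidth : ∀ {n} → Graph n → ℕ → Set
Treewidth G k =
  (Σ[ D ∈ TreeDecomposition G ] TreeDecomposition.Width D k) ×
  (∀ (D : TreeDecomposition G) j → TreeDecomposition.Width D j → k ≤ j)

-- The treewidth appears in the running time but is not part of the input
-- given to the algorithm.
record GraphOfTreewidth : Set where
  field
    {n}       : ℕ
    graph     : Graph n
    k         : ℕ
    treewidth : Treewidth graph k

-- The number of vertices, the number of edges, and the edges in any order.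
-- Adjacency lists can be computed from this in linear time, and an n-vertex
-- graph of treewidth k has at most k n edges.
encodeGraph : ∀ {n} → Graph n → List ℕ
encodeGraph {n} G =
  n ∷ length (edges G) ∷ concatMap (λ (u , v) → toℕ u ∷ toℕ v ∷ []) (edges G)

-- Distinguishing parameter value 3 (Yes) from 2 (No).
distinguish2vs3 : (∀ {n} → Graph n → ℕ → Set) → Problem
distinguish2vs3 Param = record
  { Instance = GraphOfTreewidth
  ; size     = GraphOfTreewidth.n
  ; encode   = λ I → encodeGraph (GraphOfTreewidth.graph I)
  ; Yes      = λ I → Param (GraphOfTreewidth.graph I) 3
  ; No       = λ I → Param (GraphOfTreewidth.graph I) 2
  }

-- Distinguishing 2 from 3 in 2^o(k) · n^(2-ε) time.
Distinguishable2vs3 : (∀ {n} → Graph n → ℕ → Set) → ℚ → Set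
Distinguishable2vs3 Param ε =
  Σ[ f ∈ (ℕ → ℕ) ] LittleO f × (Σ[ C ∈ ℕ ]
    SolvableWithin (distinguish2vs3 Param) (λ I t →
      t ≤ C * 2 ^ f (GraphOfTreewidth.k I) · GraphOfTreewidth.n I ^[2- ε ]))

------------------------------------------------------------------------
-- Orthogonal Vectors and Hitting Set

dot : ∀ {d} → Vec Bool d → Vec Bool d → ℕ
dot a b = sum (zipWith (λ x y → bit x * bit y) a b)

Orthogonal : ∀ {d} → Vec Bool d → Vec Bool d → Set
Orthogonal a b = dot a b ≡ 0

-- Two lists of n boolean vectors of dimension c log n.  As Subset d is
-- Vec Bool d, these are also two lists of n subsets of a universe of size
-- c log n.
record TwoLists (c : ℕ) : Set where
  field
    n            : ℕ
    .{{nonZero}} : NonZero n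

  d : ℕ
  d = c * ⌈log₂ n ⌉

  field
    A B : Vec (Vec Bool d) n

encodeTwoLists : ∀ {c} → TwoLists c → List ℕ
encodeTwoLists I = n ∷ d ∷ bits A ++ bits B
  where
  open TwoLists I
  bits : Vec (Vec Bool d) n → List ℕ
  bits X = map bit (toList (concat X))

HasOrthogonalPair : ∀ {c} → TwoLists c → Set
HasOrthogonalPair I = VecAny.Any (λ a → VecAny.Any (λ b → Orthogonal a b) B) A
  where open TwoLists I

HasHittingSet : ∀ {c} → TwoLists c → Set
HasHittingSet I = VecAny.Any (λ a → VecAll.All (λ b → Nonempty (a ∩ b)) B) A
  where open TwoLists I

decision : ∀ c → (TwoLists c → Set) → Problem
decision c Q = record
  { Instance = TwoLists c
  ; size     = TwoLists.n
  ; encode   = encodeTwoLists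
  ; Yes      = Q
  ; No       = λ I → ¬ Q I
  }

SolvableInTimeN^[2-_] : ℚ → ∀ c → (TwoLists c → Set) → Set
SolvableInTimeN^[2- ε ] c Q =
  Σ[ C ∈ ℕ ] SolvableWithin (decision c Q) (λ I t → t ≤ C · TwoLists.n I ^[2- ε ])

OVConjecture : Set
OVConjecture =
  ¬ (Σ[ ε ∈ ℚ ] Positive ε ×
      (∀ c → 1 ≤ c → SolvableInTimeN^[2- ε ] c HasOrthogonalPair))

HSConjecture : Set
HSConjecture =
  ¬ (Σ[ ε ∈ ℚ ] Positive ε ×
      (∀ c → 1 ≤ c → SolvableInTimeN^[2- ε ] c HasHittingSet))

{-# OPTIONS --safe #-}
module Submission where

-- From vectors A, B in {0,1}^d one builds a graph with a vertex per coordinate,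
-- per vector, and four hubs; a vector is adjacent to the coordinates where it
-- is 1.  Hub 0 is adjacent to all coordinates and all of A, hub 1 to all
-- coordinates, all of B and hub 0, and hub 2 to all of A.  So a ∈ A and b ∈ B
-- have distance 2 if they share a coordinate and distance 3 otherwise.  With
-- hub 2 adjacent to hub 1 and hub 3 to hubs 0 and 1, all other distances are at
-- most 2, so that the diameter detects orthogonal pairs.  With hub 3 pendant at
-- hub 2 instead, only vectors of A can have eccentricity 2, so that the radius
-- detects hitting sets.
--
-- Coordinates and hubs meet every edge, whence treewidth at most d + 4 with
-- d = c log n, and 2^o(k) is at most n^δ for every δ > 0 up to a constant.

open import Defs
open import Data.Bool.Base using (Bool; true; false; if_then_else_; T)
open import Data.Empty using (⊥; ⊥-elim)
open import Data.Fin using (#_)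
open import Data.Fin.Base using (Fin; toℕ; _↑ˡ_; _↑ʳ_; splitAt)
  renaming (zero to fzero; suc to fsuc)
import Data.Fin.Base as Fin
open import Data.Fin.Properties
  using (splitAt-↑ˡ; splitAt-↑ʳ; splitAt⁻¹-↑ˡ; splitAt⁻¹-↑ʳ; toℕ-↑ˡ; toℕ-↑ʳ; toℕ<n; any?; ¬∀⟶∃¬)
  renaming (suc-injective to fsuc-injective; _≟_ to _≟ᶠ_)
open import Data.Fin.Subset using (Subset; ∣_∣; ⁅_⁆; _∩_)
import Data.Fin.Subset as Subset
open import Data.Fin.Subset.Properties
  using (∈⊤; ∉⊥; x∈⁅x⁆; x∈⁅y⁆⇒x≡y; ∣⊤∣≡n; ∣⊥∣≡0; ∣⁅x⁆∣≡1; nonempty?; x∈p∩q⁺; x∈p∩q⁻)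
open import Data.Integer.Base using () renaming (∣_∣ to abs)
import Data.Integer.Base as ℤ
open import Data.List.Base
  using (List; []; _∷_; _++_; length; map; concatMap; tabulate; allFin; replicate)
open import Data.List.Membership.Propositional using (_∈_)
open import Data.List.Membership.Propositional.Properties
  using (∈-map⁺; ∈-map⁻; ∈-++⁺ˡ; ∈-++⁺ʳ; ∈-++⁻; ∈-tabulate⁺; ∈-tabulate⁻)
open import Data.List.Properties
  using (++-assoc; ++-identityʳ; concatMap-++; length-++; length-map; map-++; map-∘; map-cong)
open import Data.List.Relation.Unary.All using (All; []; _∷_)
import Data.List.Relation.Unary.All as All
import Data.List.Relation.Unary.All.Properties as AllP
open import Data.List.Relation.Unary.AllPairs using ([]; _∷_)
open import Data.List.Relation.Unary.Any using (here; there)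
import Data.List.Relation.Unary.Any as Any
open import Data.List.Relation.Unary.Linked using (Linked; _∷_)
open import Data.List.Relation.Unary.Unique.Propositional using (Unique)
import Data.List.Relation.Unary.Unique.Propositional.Properties as Unique
open import Data.Maybe.Base using (Maybe; just; nothing; _>>=_)
import Data.Maybe.Base as Maybe
open import Data.Nat.Base
open import Data.Nat.Coprimality using (1-coprimeTo)
open import Data.Nat.Logarithm
open import Data.Nat.Properties
open import Data.Nat.Solver using (module +-*-Solver)
open import Data.Product.Base using (Σ-syntax; ∃-syntax; _×_; _,_; proj₁; proj₂)
open import Data.Product.Properties using (≡-dec)
open import Data.Rational.Base using (ℚ; mkℚ; Positive; ↥_; ↧ₙ_)
open import Data.Sum.Base using (_⊎_; inj₁; inj₂; [_,_]′; swap)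
open import Data.Unit.Base using (⊤; tt)
open import Data.Vec.Base using (Vec; []; _∷_; lookup; toList; concat)
import Data.Vec.Base as Vec
open import Data.Vec.Properties using (toList-++)
import Data.Vec.Relation.Unary.All.Properties as VecAll
open import Data.Vec.Relation.Unary.Any using (here; there)
import Data.Vec.Relation.Unary.Any as VecAny
open import Function.Base using (_∘_; id)
open import Relation.Binary.Construct.Closure.ReflexiveTransitive
  using (Star; _◅_; _◅◅_) renaming (ε to stop)
open import Relation.Binary.PropositionalEquality
open import Relation.Nullary using (¬_; Dec; yes; no; _×-dec_; _⊎-dec_)
open import Relation.Nullary.Decidable using (map′; decidable-stable)

open +-*-Solver using (solve; con; _:+_; _:*_; _:=_)

-- Executions of word-RAM programs

-- The reduction has to be a word-RAM program itself, and this shapes most of the proof. The given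
-- program is only known to answer when started from `initial` of an encoded graph, with the word
-- length belonging to that graph. So the edges must end up at the start of an otherwise blank
-- memory, with blank registers, and longer words must be shown to do no harm. One program text
-- serves both halves of the theorem: the two graphs differ only in the smaller neighbours of hubs 2
-- and 3, which are parameters of the text. If `ε` has denominator q, then ε ≥ 1/q, and up to a
-- constant the given algorithm takes at most n^(2-1/q) times 2^o(log n) steps. Half of the gain 1/q
-- pays for the subpolynomial factor and the other half remains, so the conjecture is refuted with
-- 1/(2q). The time for building the graph, about n log n, is far below this.

T⇒≡true : ∀ {b} → T b → b ≡ true
T⇒≡true {true} _ = refl

<⇒<ᵇ≡true : ∀ {m n} → m < n → (m <ᵇ n) ≡ true
<⇒<ᵇ≡true m<n = T⇒≡true (<⇒<ᵇ m<n)

<ᵇ≡true⇒< : ∀ m n → (m <ᵇ n) ≡ true → m < n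
<ᵇ≡true⇒< m n e = <ᵇ⇒< m n (subst T (sym e) tt)

-- Without function extensionality, states can only be compared pointwise.
infix 4 _≈_

record _≈_ (σ τ : State) : Set where
  constructor pointwise
  field
    reg≈ : ∀ r → reg σ r ≡ reg τ r
    mem≈ : ∀ a → mem σ a ≡ mem τ a

open _≈_ public

≈-sym : ∀ {σ τ} → σ ≈ τ → τ ≈ σ
≈-sym (pointwise p q) = pointwise (λ r → sym (p r)) (λ a → sym (q a))

≈-trans : ∀ {σ τ υ} → σ ≈ τ → τ ≈ υ → σ ≈ υ
≈-trans (pointwise p q) (pointwise p′ q′) =
  pointwise (λ r → trans (p r) (p′ r)) (λ a → trans (q a) (q′ a))

update-cong : ∀ {f g : ℕ → ℕ} {u v} a → (∀ b → f b ≡ g b) → u ≡ v →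
              ∀ b → (f [ a ↦ u ]) b ≡ (g [ a ↦ v ]) b
update-cong a f≗g u≡v b with a ≡ᵇ b
... | true  = u≡v
... | false = f≗g b

evalOp-cong : ∀ o {x x′ y y′} → x ≡ x′ → y ≡ y′ → evalOp o x y ≡ evalOp o x′ y′
evalOp-cong o = cong₂ (evalOp o)

-- A value that fits in `w` bits also fits in `w′`, so longer words cannot introduce a crash.
assign-sim : ∀ {w w′ r v v′ σ τ σ′} → w ≤ w′ → σ ≈ τ → v ≡ v′ → assign w r v σ ≡ just σ′ →
             ∃[ τ′ ] σ′ ≈ τ′ × assign w′ r v′ τ ≡ just τ′
assign-sim {w} {w′} {r} {v} w≤w′ (pointwise p q) refl e with v <ᵇ 2 ^ w in l
assign-sim {w} {w′} {r} {v} w≤w′ (pointwise p q) refl refl | true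
  rewrite <⇒<ᵇ≡true (<-≤-trans (<ᵇ≡true⇒< v (2 ^ w) l) (^-monoʳ-≤ 2 w≤w′))
  = _ , pointwise (update-cong r p refl) q , refl

assign-step-sim : ∀ {w w′ r v v′ σ τ} {p : Program} {c} k → w ≤ w′ → σ ≈ τ → v ≡ v′ →
  Maybe.map (p ,_) (assign w r v σ) ≡ just c →
  ∃[ τ′ ] proj₂ c ≈ τ′ × Maybe.map ((p ++ k) ,_) (assign w′ r v′ τ) ≡ just (proj₁ c ++ k , τ′)
assign-step-sim {w} {r = r} {v} {σ = σ} k w≤w′ σ≈τ v≡v′ e with assign w r v σ in aeq
assign-step-sim {w} {r = r} {v} {σ = σ} k w≤w′ σ≈τ v≡v′ refl | just σ′
  with assign-sim {w} {r = r} {v} {σ = σ} w≤w′ σ≈τ v≡v′ aeq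
... | τ′ , σ′≈τ′ , ae′ rewrite ae′ = τ′ , σ′≈τ′ , refl

step-sim : ∀ {w w′ i p σ τ c} k → w ≤ w′ → σ ≈ τ → step w (i ∷ p , σ) ≡ just c →
           ∃[ τ′ ] proj₂ c ≈ τ′ × step w′ (i ∷ p ++ k , τ) ≡ just (proj₁ c ++ k , τ′)
step-sim {w} {i = set r v} {σ = σ} k w≤w′ σ≈τ e =
  assign-step-sim {w} {r = r} {v} {σ = σ} k w≤w′ σ≈τ refl e
step-sim {w} {i = op o r s s′} {σ = σ} k w≤w′ σ≈τ e =
  assign-step-sim {w} {r = r} {σ = σ} k w≤w′ σ≈τ
    (evalOp-cong o (reg≈ σ≈τ s) (reg≈ σ≈τ s′)) e
step-sim {w} {i = load r s} {σ = σ} {τ} k w≤w′ σ≈τ e =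
  assign-step-sim {w} {r = r} {σ = σ} k w≤w′ σ≈τ
    (trans (mem≈ σ≈τ (reg σ s)) (cong (mem τ) (reg≈ σ≈τ s))) e
step-sim {i = store r s} {σ = σ} {τ} k w≤w′ (pointwise p q) refl rewrite sym (p r) =
  _ , pointwise p (update-cong (reg σ r) q (p s)) , refl
step-sim {i = ifNonzero r p₁ p₂} {p} {σ} k w≤w′ σ≈τ e
  rewrite sym (reg≈ σ≈τ r) with reg σ r
step-sim {i = ifNonzero r p₁ p₂} {p} {σ} k w≤w′ σ≈τ refl | zero
  rewrite ++-assoc p₂ p k = _ , σ≈τ , refl
step-sim {i = ifNonzero r p₁ p₂} {p} {σ} k w≤w′ σ≈τ refl | suc _
  rewrite ++-assoc p₁ p k = _ , σ≈τ , refl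
step-sim {i = while r p₁} {p} {σ} k w≤w′ σ≈τ e
  rewrite sym (reg≈ σ≈τ r) with reg σ r
step-sim {i = while r p₁} {p} {σ} k w≤w′ σ≈τ refl | zero = _ , σ≈τ , refl
step-sim {i = while r p₁} {p} {σ} k w≤w′ σ≈τ refl | suc _
  rewrite ++-assoc p₁ (while r p₁ ∷ p) k = _ , σ≈τ , refl

run-+ : ∀ w s {t c d} → run w s c ≡ just d → run w (s + t) c ≡ run w t d
run-+ w zero refl = refl
run-+ w (suc s) {c = c} e with step w c
... | just c′ = run-+ w s e

run-halted : ∀ w t {σ} → run w t ([] , σ) ≡ just ([] , σ)
run-halted w zero    = refl
run-halted w (suc t) = run-halted w t

-- This lets a program specified alone and for short words run inside a longer program with longer
-- words. A halted machine idles until step `t`, whereas with `k` appended it would go on into `k`;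
-- hence only some `s ≤ t` steps are claimed.
run-sim : ∀ {w w′} t {p σ τ σ′} k → w ≤ w′ → σ ≈ τ → run w t (p , σ) ≡ just ([] , σ′) →
          ∃[ s ] ∃[ τ′ ] s ≤ t × σ′ ≈ τ′ × run w′ s (p ++ k , τ) ≡ just (k , τ′)
run-sim {w} t {[]} k w≤w′ σ≈τ e with refl ← trans (sym (run-halted w t)) e =
  0 , _ , z≤n , σ≈τ , refl
run-sim {w} (suc t) {i ∷ p} {σ} k w≤w′ σ≈τ e with step w (i ∷ p , σ) in seq
... | just c with step-sim {i = i} {p = p} {σ = σ} k w≤w′ σ≈τ seq
... | τ₁ , σ₁≈τ₁ , se′ with run-sim t {proj₁ c} k w≤w′ σ₁≈τ₁ e
... | s , τ′ , s≤t , σ′≈τ′ , e′ =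
  suc s , τ′ , s≤s s≤t , σ′≈τ′ , trans (cong (_>>= run _ s) se′) e′

-- Lists replace functions because a write to a list computes; the effect of straight-line register
-- code is then checked by conversion alone.
put : List ℕ → ℕ → ℕ → List ℕ
put []       zero    v = v ∷ []
put []       (suc a) v = 0 ∷ put [] a v
put (x ∷ xs) zero    v = v ∷ xs
put (x ∷ xs) (suc a) v = x ∷ put xs a v

cells-put : ∀ xs a v b → (cells xs [ a ↦ v ]) b ≡ cells (put xs a v) b
cells-put []       zero    v zero    = refl
cells-put []       zero    v (suc b) = refl
cells-put []       (suc a) v zero    = refl
cells-put []       (suc a) v (suc b) = cells-put [] a v b
cells-put (x ∷ xs) zero    v zero    = refl
cells-put (x ∷ xs) zero    v (suc b) = refl
cells-put (x ∷ xs) (suc a) v zero    = refl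
cells-put (x ∷ xs) (suc a) v (suc b) = cells-put xs a v b

-- Registers and memory, with zeros beyond the end of the lists.
Mach : Set
Mach = List ℕ × List ℕ

⟦_⟧ : Mach → State
⟦ R , M ⟧ = state (cells R) (cells M)

Bounded : ℕ → Mach → Set
Bounded B (R , M) = (∀ r → cells R r ≤ B) × (∀ a → cells M a ≤ B)

bounded-≤ : ∀ {B B′} S → B ≤ B′ → Bounded B S → Bounded B′ S
bounded-≤ S B≤B′ (p , q) = (λ r → ≤-trans (p r) B≤B′) , (λ a → ≤-trans (q a) B≤B′)

cells-put-≤ : ∀ {B} xs a v → (∀ b → cells xs b ≤ B) → v ≤ B → ∀ b → cells (put xs a v) b ≤ B
cells-put-≤ xs a v p q b rewrite sym (cells-put xs a v b) with a ≡ᵇ b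
... | true  = q
... | false = p b

-- The cost bounds both the running time and the growth of the largest value,
-- so that absence of overflow needs to be checked only once, at the end.

record Exec (p : Program) (S : Mach) (cost : ℕ) (S′ : Mach) : Set where
  constructor exec
  field
    bounded : ∀ B → Bounded B S → Bounded (B + cost) S′
    runs    : ∀ w B → Bounded B S → B + cost < 2 ^ w → ∀ σ k → σ ≈ ⟦ S ⟧ →
              ∃[ t ] ∃[ σ′ ] t ≤ cost × σ′ ≈ ⟦ S′ ⟧ × run w t (p ++ k , σ) ≡ just (k , σ′)

open Exec public

skip : ∀ {S} → Exec [] S 0 S
skip {S} = exec (λ B → bounded-≤ S (m≤m+n B 0)) (λ _ _ _ _ σ k σ≈S → 0 , σ , z≤n , σ≈S , refl)

sequence : ∀ {p q S S′ S″ a b} → Exec p S a S′ → Exec q S′ b S″ → Exec (p ++ q) S (a + b) S″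
sequence {p} {q} {S} {S′} {S″} {a} {b} P Q = exec
  (λ B h → subst (λ c → Bounded c S″) (+-assoc B a b) (bounded Q (B + a) (bounded P B h)))
  λ w B h l σ k σ≈S →
    let l′ = subst (_< 2 ^ w) (sym (+-assoc B a b)) l
        t , σ′ , t≤a , σ′≈S′ , e =
          runs P w B h (≤-<-trans (m≤m+n (B + a) b) l′) σ (q ++ k) σ≈S
        t′ , σ″ , t′≤b , σ″≈S″ , e′ =
          runs Q w (B + a) (bounded P B h) l′ σ′ k σ′≈S′
    in t + t′ , σ″ , +-mono-≤ t≤a t′≤b , σ″≈S″ ,
       trans (cong (λ l → run w (t + t′) (l , σ)) (++-assoc p q k)) (trans (run-+ w t e) e′)

infixr 5 _▸_

_▸_ : ∀ {i q S S′ S″ a b} → Exec (i ∷ []) S a S′ → Exec q S′ b S″ → Exec (i ∷ q) S (a + b) S″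
_▸_ = sequence

weaken : ∀ {p S S′ a b} → a ≤ b → Exec p S a S′ → Exec p S b S′
weaken {S′ = S′} a≤b P = exec
  (λ B h → bounded-≤ S′ (+-monoʳ-≤ B a≤b) (bounded P B h))
  λ w B h l σ k σ≈S →
    let t , σ′ , t≤a , rest = runs P w B h (≤-<-trans (+-monoʳ-≤ B a≤b) l) σ k σ≈S
    in t , σ′ , ≤-trans t≤a a≤b , rest

cast : ∀ {p S S′ S″ a} → S′ ≡ S″ → Exec p S a S′ → Exec p S a S″
cast refl P = P

assign-ok : ∀ i r v c {R M} → 1 ≤ c →
  (∀ w σ k → σ ≈ ⟦ R , M ⟧ → step w (i ∷ k , σ) ≡ Maybe.map (k ,_) (assign w r v σ)) →
  (∀ B → Bounded B (R , M) → v ≤ B + c) →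
  Exec (i ∷ []) (R , M) c (put R r v , M)
assign-ok i r v c {R} {M} 1≤c steps v≤ = exec
  (λ B h → cells-put-≤ R r v (proj₁ (bounded-≤ (R , M) (m≤m+n B c) h)) (v≤ B h) ,
           proj₂ (bounded-≤ (R , M) (m≤m+n B c) h))
  λ w B h l σ k σ≈S → 1 , _ , 1≤c ,
    pointwise (λ b → trans (update-cong r (reg≈ σ≈S) refl b) (cells-put R r v b)) (mem≈ σ≈S) ,
    cong (_>>= run w 0) (trans (steps w σ k σ≈S)
      (cong (Maybe.map (k ,_))
        (cong (λ b → if b then just (state (reg σ [ r ↦ v ]) (mem σ)) else nothing)
          (<⇒<ᵇ≡true {v} {2 ^ w} (≤-<-trans (v≤ B h) l)))))

-- The single step is charged `suc v`, because the constant may exceed every value present so far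
-- and the cost must account for that growth.
set-ok : ∀ r v {R M} → Exec (set r v ∷ []) (R , M) (suc v) (put R r v , M)
set-ok r v = assign-ok _ r v (suc v) (s≤s z≤n) (λ _ _ _ _ → refl)
  (λ B _ → ≤-trans (n≤1+n v) (m≤n+m (suc v) B))

op-step : ∀ o r s s′ R M w σ k → σ ≈ ⟦ R , M ⟧ →
  step w (op o r s s′ ∷ k , σ) ≡ Maybe.map (k ,_) (assign w r (evalOp o (cells R s) (cells R s′)) σ)
op-step o r s s′ R M w σ k σ≈S =
  cong (λ v → Maybe.map (k ,_) (assign w r v σ)) (evalOp-cong o (reg≈ σ≈S s) (reg≈ σ≈S s′))

-- Charging the whole result is affordable only outside loops. Inside loops, the cheaper rules for
-- `inc`, `dec` and `copy` keep the cost of each iteration constant.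
op-ok : ∀ o r s s′ {R M} → let v = evalOp o (cells R s) (cells R s′) in
        Exec (op o r s s′ ∷ []) (R , M) (suc v) (put R r v , M)
op-ok o r s s′ {R} {M} = assign-ok _ r _ _ (s≤s z≤n) (op-step o r s s′ R M)
  (λ B _ → ≤-trans (n≤1+n _) (m≤n+m (suc _) B))

-- Operations take no immediate operands. The convention is that register 0 holds 1 and register 1
-- holds 0, so that adding or subtracting register 0 counts and subtracting register 1 copies.
inc dec : ℕ → Instr
inc r = op add r 0 r
dec r = op sub r r 0

copy : ℕ → ℕ → Instr
copy r s = op sub r s 1

inc-ok : ∀ r {R M} → Exec (inc r ∷ []) (1 ∷ R , M) 1 (put (1 ∷ R) r (suc (cells (1 ∷ R) r)) , M)
inc-ok r {R} {M} = assign-ok _ r _ 1 ≤-refl (op-step add r 0 r (1 ∷ R) M)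
  (λ B h → subst (suc (cells (1 ∷ R) r) ≤_) (+-comm 1 B) (s≤s (proj₁ h r)))

dec-ok : ∀ r {R M} → Exec (dec r ∷ []) (1 ∷ R , M) 1 (put (1 ∷ R) r (cells (1 ∷ R) r ∸ 1) , M)
dec-ok r {R} {M} = assign-ok _ r _ 1 ≤-refl (op-step sub r r 0 (1 ∷ R) M)
  (λ B h → ≤-trans (m∸n≤m (cells (1 ∷ R) r) 1) (≤-trans (proj₁ h r) (m≤m+n B 1)))

copy-ok : ∀ r s {R M} →
          Exec (copy r s ∷ []) (1 ∷ 0 ∷ R , M) 1 (put (1 ∷ 0 ∷ R) r (cells (1 ∷ 0 ∷ R) s) , M)
copy-ok r s {R} {M} = assign-ok _ r _ 1 ≤-refl (op-step sub r s 1 (1 ∷ 0 ∷ R) M)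
  (λ B h → ≤-trans (proj₁ h s) (m≤m+n B 1))

load-ok : ∀ r s {R M} → Exec (load r s ∷ []) (R , M) 1 (put R r (cells M (cells R s)) , M)
load-ok r s {R} {M} = assign-ok _ r _ 1 ≤-refl
  (λ w σ k σ≈S → cong (λ v → Maybe.map (k ,_) (assign w r v σ))
    (trans (mem≈ σ≈S (reg σ s)) (cong (cells M) (reg≈ σ≈S s))))
  (λ B h → ≤-trans (proj₂ h (cells R s)) (m≤m+n B 1))

store-ok : ∀ r s {R M} → Exec (store r s ∷ []) (R , M) 1 (R , put M (cells R r) (cells R s))
store-ok r s {R} {M} = exec
  (λ B h → proj₁ (bounded-≤ (R , M) (m≤m+n B 1) h) ,
           cells-put-≤ M _ _ (proj₂ (bounded-≤ (R , M) (m≤m+n B 1) h))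
             (≤-trans (proj₁ h s) (m≤m+n B 1)))
  λ w B h l σ k σ≈S → 1 , _ , ≤-refl ,
    pointwise (reg≈ σ≈S) (λ b → trans
      (trans (cong (λ a → (mem σ [ a ↦ reg σ s ]) b) (reg≈ σ≈S r))
             (update-cong (cells R r) (mem≈ σ≈S) (reg≈ σ≈S s) b))
      (cells-put M (cells R r) (cells R s) b)) ,
    refl

step-first : ∀ i {p q S S′ c} → Exec q S c S′ →
  (∀ w σ k → σ ≈ ⟦ S ⟧ → step w (i ∷ p ++ k , σ) ≡ just (q ++ k , σ)) →
  Exec (i ∷ p) S (suc c) S′
step-first i {S′ = S′} {c} Q steps = exec
  (λ B h → bounded-≤ S′ (+-monoʳ-≤ B (n≤1+n c)) (bounded Q B h))
  λ w B h l σ k σ≈S →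
    let t , σ′ , t≤c , σ′≈S′ , e =
          runs Q w B h (≤-<-trans (+-monoʳ-≤ B (n≤1+n c)) l) σ k σ≈S
    in suc t , σ′ , s≤s t≤c , σ′≈S′ , trans (cong (_>>= run w t) (steps w σ k σ≈S)) e

if-zero : ∀ r {p q R M S′ c} → cells R r ≡ 0 → Exec q (R , M) c S′ →
          Exec (ifNonzero r p q ∷ []) (R , M) (suc c) S′
if-zero r {p} {q} {R} {M} e Q = step-first _ Q steps
  where
  steps : ∀ w σ k → σ ≈ ⟦ R , M ⟧ → step w (ifNonzero r p q ∷ k , σ) ≡ just (q ++ k , σ)
  steps w σ k σ≈S rewrite trans (reg≈ σ≈S r) e = refl

if-suc : ∀ r {p q R M S′ c m} → cells R r ≡ suc m → Exec p (R , M) c S′ →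
         Exec (ifNonzero r p q ∷ []) (R , M) (suc c) S′
if-suc r {p} {q} {R} {M} e P = step-first _ P steps
  where
  steps : ∀ w σ k → σ ≈ ⟦ R , M ⟧ → step w (ifNonzero r p q ∷ k , σ) ≡ just (p ++ k , σ)
  steps w σ k σ≈S rewrite trans (reg≈ σ≈S r) e = refl

while-zero : ∀ r {p R M} → cells R r ≡ 0 → Exec (while r p ∷ []) (R , M) 1 (R , M)
while-zero r {p} {R} {M} e = step-first _ skip steps
  where
  steps : ∀ w σ k → σ ≈ ⟦ R , M ⟧ → step w (while r p ∷ k , σ) ≡ just (k , σ)
  steps w σ k σ≈S rewrite trans (reg≈ σ≈S r) e = refl

while-suc : ∀ r {p R M S′ S″ a b m} → cells R r ≡ suc m →
            Exec p (R , M) a S′ → Exec (while r p ∷ []) S′ b S″ →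
            Exec (while r p ∷ []) (R , M) (suc (a + b)) S″
while-suc r {p} {R} {M} e P Q = step-first _ (sequence P Q) steps
  where
  steps : ∀ w σ k → σ ≈ ⟦ R , M ⟧ →
          step w (while r p ∷ k , σ) ≡ just ((p ++ while r p ∷ []) ++ k , σ)
  steps w σ k σ≈S rewrite trans (reg≈ σ≈S r) e | ++-assoc p (while r p ∷ []) k = refl

-- The program writing the graph

put-end₂ : ∀ M a b → put (put M (length M) a) (suc (length M)) b ≡ M ++ a ∷ b ∷ []
put-end₂ []      a b = refl
put-end₂ (x ∷ M) a b = cong (x ∷_) (put-end₂ M a b)

length-end₂ : ∀ (M : List ℕ) a b → length (M ++ a ∷ b ∷ []) ≡ suc (suc (length M))
length-end₂ []      a b = refl
length-end₂ (x ∷ M) a b = cong suc (length-end₂ M a b)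

cells-++ˡ : ∀ M M′ {a} → a < length M → cells (M ++ M′) a ≡ cells M a
cells-++ˡ (x ∷ M) M′ {zero}  _         = refl
cells-++ˡ (x ∷ M) M′ {suc a} (s≤s a<M) = cells-++ˡ M M′ a<M

-- Registers: 0 holds the constant 1, 1 the constant 0, 2 and 3 the input
-- parameters n and d, 4 a reading position, 5 a writing position, 6 the
-- current vertex, 7 the current coordinate, 8 and 9 loop counters, 10 scratch,
-- 11 the number of edges, and 12 to 15 the hubs.
regs : (n d ptr out v j c o t m : ℕ) → List ℕ
regs n d ptr out v j c o t m =
  1 ∷ 0 ∷ n ∷ d ∷ ptr ∷ out ∷ v ∷ j ∷ c ∷ o ∷ t ∷ m ∷
  d ∷ suc d ∷ suc (suc d) ∷ suc (suc (suc d)) ∷ []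

-- The writing position is tied to the length of the memory, so that every emitted edge is appended
-- at the end.
writing : (n d ptr v j c o t m : ℕ) → List ℕ → Mach
writing n d ptr v j c o t m M = regs n d ptr (length M) v j c o t m , M

rowEnc : ℕ → List ℕ → List ℕ
rowEnc v = concatMap (λ u → u ∷ v ∷ [])

-- Register `r` supplies the smaller endpoint, register 6 the larger one, in the order required by
-- `encodeGraph`.
emit : ℕ → Program
emit r = store 5 r ∷ inc 5 ∷ store 5 6 ∷ inc 5 ∷ inc 11 ∷ []

emit-ok : ∀ r {n d ptr v j c o t m M} →
  Exec (emit r) (writing n d ptr v j c o t m M) 5
       (writing n d ptr v j c o t (suc m)
         (M ++ cells (regs n d ptr (length M) v j c o t m) r ∷ v ∷ []))
emit-ok r {n} {d} {ptr} {v} {j} {c} {o} {t} {m} {M} =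
  cast (cong₂ (λ l M′ → regs n d ptr l v j c o t (suc m) , M′)
         (sym (length-end₂ M _ v)) (put-end₂ M _ v))
       (store-ok 5 r ▸ inc-ok 5 ▸ store-ok 5 6 ▸ inc-ok 5 ▸ inc-ok 11)

emitHubs : List (Fin 4) → Program
emitHubs = concatMap (λ h → emit (12 + toℕ h))

hubs : ℕ → List (Fin 4) → List ℕ
hubs d = map (λ h → toℕ h + d)

hub-reg : ∀ (h : Fin 4) {n d ptr out v j c o t m} →
          cells (regs n d ptr out v j c o t m) (12 + toℕ h) ≡ toℕ h + d
hub-reg fzero                       = refl
hub-reg (fsuc fzero)                = refl
hub-reg (fsuc (fsuc fzero))         = refl
hub-reg (fsuc (fsuc (fsuc fzero)))  = refl

emitHubs-ok : ∀ hs {n d ptr v j c o t m M} →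
  Exec (emitHubs hs) (writing n d ptr v j c o t m M) (length hs * 5)
       (writing n d ptr v j c o t (length hs + m) (M ++ rowEnc v (hubs d hs)))
emitHubs-ok []       {n} {d} {ptr} {v} {j} {c} {o} {t} {m} {M} =
  cast (cong (writing n d ptr v j c o t m) (sym (++-identityʳ M))) skip
emitHubs-ok (h ∷ hs) {n} {d} {ptr} {v} {j} {c} {o} {t} {m} {M} =
  sequence {p = emit (12 + toℕ h)}
    (cast (cong (λ u → writing n d ptr v j c o t (suc m) (M ++ u ∷ v ∷ []))
                (hub-reg h {n} {d} {ptr} {length M} {v} {j} {c} {o} {t} {m}))
          (emit-ok (12 + toℕ h)))
    (cast (cong₂ (writing n d ptr v j c o t)
            (+-suc (length hs) m) (++-assoc M _ (rowEnc v (hubs d hs))))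
          (emitHubs-ok hs))

-- Coordinates carry the smallest vertex numbers, so with `j` = 0 these positions are already the
-- numbers of the neighbouring coordinate vertices.
pick : ℕ → ∀ {e} → Vec Bool e → List ℕ
pick j []           = []
pick j (true ∷ bs)  = j ∷ pick (suc j) bs
pick j (false ∷ bs) = pick (suc j) bs

-- The bound `p < length M` makes the property survive appending: beyond the end `cells` gives 0,
-- which would pass for a false bit until edges are written there.
Reads : List ℕ → ℕ → ∀ {e} → Vec Bool e → Set
Reads M p []       = ⊤
Reads M p (b ∷ bs) = p < length M × cells M p ≡ bit b × Reads M (suc p) bs

reads-++ : ∀ M M′ p {e} (bs : Vec Bool e) → Reads M p bs → Reads (M ++ M′) p bs
reads-++ M M′ p []       _                = tt
reads-++ M M′ p (b ∷ bs) (p<M , eq₁ , rs) =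
  ≤-trans p<M (subst (length M ≤_) (sym (length-++ M)) (m≤m+n _ _)) ,
  trans (cells-++ˡ M M′ p<M) eq₁ , reads-++ M M′ (suc p) bs rs

scanBody : Program
scanBody = load 10 4 ∷ inc 4 ∷ ifNonzero 10 (emit 7) [] ∷ set 10 0 ∷ inc 7 ∷ dec 8 ∷ []

writing-cong : ∀ {n d v c o t ptr ptr′ j j′ m m′ M M′} →
  ptr ≡ ptr′ → j ≡ j′ → m ≡ m′ → M ≡ M′ →
  writing n d ptr v j c o t m M ≡ writing n d ptr′ v j′ c o t m′ M′
writing-cong refl refl refl refl = refl

scan-ok : ∀ {e} (bs : Vec Bool e) {n d ptr v j o m M} → Reads M ptr bs →
  Exec (while 8 scanBody ∷ []) (writing n d ptr v j e o 0 m M) (suc (e * 12))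
       (writing n d (e + ptr) v (e + j) 0 o 0 (length (pick j bs) + m)
         (M ++ rowEnc v (pick j bs)))
scan-ok [] {M = M} _ =
  cast (writing-cong refl refl refl (sym (++-identityʳ M))) (while-zero 8 refl)
scan-ok {suc e} (true ∷ bs) {n} {d} {ptr} {v} {j} {o} {m} {M} (_ , bit≡ , rs) =
  while-suc 8 refl
    (load-ok 10 4 ▸ inc-ok 4 ▸ if-suc 10 bit≡ (emit-ok 7) ▸ set-ok 10 0 ▸ inc-ok 7 ▸ dec-ok 8)
    (cast (writing-cong (+-suc e ptr) (+-suc e j) (+-suc _ m) (++-assoc M _ _))
          (scan-ok bs (reads-++ M (j ∷ v ∷ []) (suc ptr) bs rs)))
scan-ok {suc e} (false ∷ bs) {n} {d} {ptr} {v} {j} {o} {m} {M} (_ , bit≡ , rs) =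
  while-suc 8 refl
    -- Without the 5 steps of `emit` the body costs 6; padding to 11 gives both branches the same
    -- cost, which the loop test raises to 12.
    (weaken {b = 11} (m≤m+n 6 5)
      (load-ok 10 4 ▸ inc-ok 4 ▸ if-zero 10 bit≡ skip ▸ set-ok 10 0 ▸ inc-ok 7 ▸ dec-ok 8))
    (cast (writing-cong (+-suc e ptr) (+-suc e j) refl refl) (scan-ok bs rs))

fillBody : Program
fillBody = emit 7 ++ inc 7 ∷ dec 8 ∷ []

-- The complete row is phrased through an all-true vector, so that it matches `coords` and shares
-- `endRow-ok` with the rows of vectors.
fill-ok : ∀ e {n d ptr v j o m M} →
  let us = pick j (Vec.replicate e true) in
  Exec (while 8 fillBody ∷ []) (writing n d ptr v j e o 0 m M) (suc (e * 8))
       (writing n d ptr v (e + j) 0 o 0 (length us + m) (M ++ rowEnc v us))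
fill-ok zero {M = M} =
  cast (writing-cong refl refl refl (sym (++-identityʳ M))) (while-zero 8 refl)
fill-ok (suc e) {n} {d} {ptr} {v} {j} {o} {m} {M} =
  while-suc 8 refl
    (sequence {p = emit 7} (emit-ok 7) (inc-ok 7 ▸ dec-ok 8))
    (cast (writing-cong refl (+-suc e j) (+-suc _ m) (++-assoc M _ _)) (fill-ok e))

rowEnc-++ : ∀ M v us us′ →
  (M ++ rowEnc v us) ++ rowEnc v us′ ≡ M ++ rowEnc v (us ++ us′)
rowEnc-++ M v us us′ = trans (++-assoc M _ _) (cong (M ++_) (sym (concatMap-++ _ us us′)))

count-++ : ∀ (us us′ : List ℕ) m → length us′ + (length us + m) ≡ length (us ++ us′) + m
count-++ us us′ m = trans (sym (+-assoc (length us′) (length us) m))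
  (cong (_+ m) (trans (+-comm (length us′) (length us)) (sym (length-++ us))))

endRow : List (Fin 4) → Program
endRow hs = emitHubs hs ++ inc 6 ∷ []

endRow-ok : ∀ us hs {n d ptr v o m M} →
  let us′ = us ++ hubs d hs in
  Exec (endRow hs) (writing n d ptr v 0 0 o 0 (length us + m) (M ++ rowEnc v us)) (length hs * 5 + 1)
       (writing n d ptr (suc v) 0 0 o 0 (length us′ + m) (M ++ rowEnc v us′))
endRow-ok us hs {n} {d} {v = v} {m = m} {M} = sequence (emitHubs-ok hs)
  (cast (writing-cong refl refl
          (trans (cong (_+ (length us + m)) (sym (length-map _ hs))) (count-++ us (hubs d hs) m))
          (rowEnc-++ M v us (hubs d hs)))
        (inc-ok 6))

fullRow : List (Fin 4) → Program
fullRow hs = copy 8 3 ∷ while 8 fillBody ∷ set 7 0 ∷ endRow hs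

fullRow-ok : ∀ hs {n d ptr v o m M} →
  let us = pick 0 (Vec.replicate d true) ++ hubs d hs in
  Exec (fullRow hs) (writing n d ptr v 0 0 o 0 m M) (d * 8 + 4 + length hs * 5)
       (writing n d ptr (suc v) 0 0 o 0 (length us + m) (M ++ rowEnc v us))
fullRow-ok hs {d = d} = weaken (≤-reflexive cost)
  (copy-ok 8 3 ▸ fill-ok d ▸ set-ok 7 0 ▸ endRow-ok (pick 0 (Vec.replicate d true)) hs)
  where
  cost : 1 + (suc (d * 8) + (1 + (length hs * 5 + 1))) ≡ d * 8 + 4 + length hs * 5
  cost = solve 2 (λ x y → con 1 :+ (con 1 :+ x :+ (con 1 :+ (y :+ con 1))) := x :+ con 4 :+ y)
           refl (d * 8) (length hs * 5)

vectorRow : List (Fin 4) → Program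
vectorRow hs = copy 8 3 ∷ while 8 scanBody ∷ set 7 0 ∷ endRow hs

vectorRow-ok : ∀ hs {n d ptr v o m M} (bs : Vec Bool d) → Reads M ptr bs →
  let us = pick 0 bs ++ hubs d hs in
  Exec (vectorRow hs) (writing n d ptr v 0 0 o 0 m M) (d * 12 + 4 + length hs * 5)
       (writing n d (d + ptr) (suc v) 0 0 o 0 (length us + m) (M ++ rowEnc v us))
vectorRow-ok hs {d = d} bs rs = weaken (≤-reflexive cost)
  (copy-ok 8 3 ▸ scan-ok bs rs ▸ set-ok 7 0 ▸ endRow-ok (pick 0 bs) hs)
  where
  cost : 1 + (suc (d * 12) + (1 + (length hs * 5 + 1))) ≡ d * 12 + 4 + length hs * 5
  cost = solve 2 (λ x y → con 1 :+ (con 1 :+ x :+ (con 1 :+ (y :+ con 1))) := x :+ con 4 :+ y)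
           refl (d * 12) (length hs * 5)

ReadsRows : List ℕ → ℕ → ∀ {d e} → Vec (Vec Bool d) e → Set
ReadsRows M p         []         = ⊤
ReadsRows M p {d}     (bs ∷ bss) = Reads M p bs × ReadsRows M (d + p) bss

readsRows-++ : ∀ M M′ p {d e} (bss : Vec (Vec Bool d) e) →
               ReadsRows M p bss → ReadsRows (M ++ M′) p bss
readsRows-++ M M′ p []         _         = tt
readsRows-++ M M′ p (bs ∷ bss) (rs , rss) = reads-++ M M′ p bs rs , readsRows-++ M M′ _ bss rss

rowsEnc : List (Fin 4) → ℕ → ∀ {d e} → Vec (Vec Bool d) e → List ℕ
rowsEnc hs v []                 = []
rowsEnc hs v {d} (bs ∷ bss) = rowEnc v (pick 0 bs ++ hubs d hs) ++ rowsEnc hs (suc v) bss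

rowsCount : List (Fin 4) → ∀ {d e} → Vec (Vec Bool d) e → ℕ
rowsCount hs []             = 0
rowsCount hs {d} (bs ∷ bss) = rowsCount hs bss + length (pick 0 bs ++ hubs d hs)

rowsEnd : ∀ {d e} → Vec (Vec Bool d) e → ℕ → ℕ
rowsEnd []             p = p
rowsEnd {d} (bs ∷ bss) p = rowsEnd bss (d + p)

vectorRows : List (Fin 4) → Program
vectorRows hs = while 9 (vectorRow hs ++ dec 9 ∷ []) ∷ []

vectorRows-ok : ∀ hs {n d ptr v m M e} (bss : Vec (Vec Bool d) e) → ReadsRows M ptr bss →
  Exec (vectorRows hs) (writing n d ptr v 0 0 e 0 m M) (suc (e * (d * 12 + 6 + length hs * 5)))
       (writing n d (rowsEnd bss ptr) (e + v) 0 0 0 0 (rowsCount hs bss + m) (M ++ rowsEnc hs v bss))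
vectorRows-ok hs {M = M} [] _ =
  cast (writing-cong refl refl refl (sym (++-identityʳ M))) (while-zero 9 refl)
vectorRows-ok hs {n} {d} {ptr} {v} {m} {M} {suc e} (bs ∷ bss) (rs , rss) =
  weaken (≤-reflexive cost) (while-suc 9 refl
    (sequence (vectorRow-ok hs bs rs) (dec-ok 9))
    (cast eq₂ (vectorRows-ok hs bss (readsRows-++ M _ _ bss rss))))
  where
  us = pick 0 bs ++ hubs d hs
  eq₂ : writing n d (rowsEnd bss (d + ptr)) (e + suc v) 0 0 0 0
          (rowsCount hs bss + (length us + m)) ((M ++ rowEnc v us) ++ rowsEnc hs (suc v) bss)
      ≡ writing n d (rowsEnd bss (d + ptr)) (suc e + v) 0 0 0 0
          (rowsCount hs (bs ∷ bss) + m) (M ++ rowsEnc hs v (bs ∷ bss))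
  eq₂ rewrite +-suc e v | ++-assoc M (rowEnc v us) (rowsEnc hs (suc v) bss)
            | +-assoc (rowsCount hs bss) (length us) m = refl
  cost : suc ((d * 12 + 4 + length hs * 5 + 1) + suc (e * (d * 12 + 6 + length hs * 5)))
         ≡ suc (suc e * (d * 12 + 6 + length hs * 5))
  cost = solve 3 (λ x y z → con 1 :+ ((x :+ con 4 :+ y :+ con 1) :+ (con 1 :+ z))
                            := con 1 :+ (x :+ con 6 :+ y :+ z))
           refl (d * 12) (length hs * 5) (e * (d * 12 + 6 + length hs * 5))

-- Moving the edges to the front and blanking the machine

cells-++ʳ : ∀ M M′ a → cells (M ++ M′) (a + length M) ≡ cells M′ a
cells-++ʳ []      M′ a = cong (cells M′) (+-identityʳ a)
cells-++ʳ (x ∷ M) M′ a =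
  trans (cong (cells (x ∷ M ++ M′)) (+-suc a (length M))) (cells-++ʳ M M′ a)

put-++ : ∀ X y Y v → put (X ++ y ∷ Y) (length X) v ≡ (X ++ v ∷ []) ++ Y
put-++ []      y Y v = refl
put-++ (x ∷ X) y Y v = cong (x ∷_) (put-++ X y Y v)

length-snoc : ∀ (X : List ℕ) v → length (X ++ v ∷ []) ≡ suc (length X)
length-snoc X v = trans (length-++ X) (+-comm (length X) 1)

-- The length is kept: the last `s` entries are read from beyond the end and become 0, which erases
-- the old contents there.
shiftBy : ℕ → List ℕ → List ℕ
shiftBy s []      = []
shiftBy s (y ∷ Y) = cells (y ∷ Y) s ∷ shiftBy s Y

cells-shiftBy : ∀ s Y i → cells (shiftBy s Y) i ≡ cells Y (i + s)
cells-shiftBy s []      i       = refl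
cells-shiftBy s (y ∷ Y) zero    = refl
cells-shiftBy s (y ∷ Y) (suc i) = cells-shiftBy s Y i

shiftBody : Program
shiftBody = load 10 4 ∷ store 7 10 ∷ set 10 0 ∷ inc 4 ∷ inc 7 ∷ dec 8 ∷ []

-- `X` is the part already overwritten and `Y` the untouched rest. The reading position is never
-- behind the writing position, so every value read is still the original one.
shift-ok : ∀ X Y s {n d out v m} →
  Exec (while 8 shiftBody ∷ [])
       (regs n d (s + length X) out v (length X) (length Y) 0 0 m , X ++ Y)
       (suc (length Y * 7))
       (regs n d (s + (length Y + length X)) out v (length Y + length X) 0 0 0 m , X ++ shiftBy s Y)
shift-ok X []      s = while-zero 8 refl
shift-ok X (y ∷ Y) s {n} {d} {out} {v} {m} =
  while-suc 8 refl
    (cast body≡ (load-ok 10 4 ▸ store-ok 7 10 ▸ set-ok 10 0 ▸ inc-ok 4 ▸ inc-ok 7 ▸ dec-ok 8))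
    (cast rest≡ (shift-ok (X ++ b ∷ []) Y s))
  where
  b = cells (y ∷ Y) s
  X′ = X ++ b ∷ []
  body≡ : _≡_ {A = Mach} (regs n d (suc (s + length X)) out v (suc (length X)) (length Y) 0 0 m ,
           put (X ++ y ∷ Y) (length X) (cells (X ++ y ∷ Y) (s + length X)))
          (regs n d (s + length X′) out v (length X′) (length Y) 0 0 m , X′ ++ Y)
  body≡ rewrite length-snoc X b | +-suc s (length X) | cells-++ʳ X (y ∷ Y) s | put-++ X y Y b = refl
  rest≡ : _≡_ {A = Mach} (regs n d (s + (length Y + length X′)) out v (length Y + length X′) 0 0 0 m ,
           X′ ++ shiftBy s Y)
          (regs n d (s + (suc (length Y) + length X)) out v (suc (length Y) + length X) 0 0 0 m ,
           X ++ shiftBy s (y ∷ Y))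
  rest≡ rewrite length-snoc X b | +-suc (length Y) (length X) | ++-assoc X (b ∷ []) (shiftBy s Y) = refl

noRegs : List ℕ
noRegs = replicate 16 0

prologue : Program
prologue =
  -- Registers 1 and 0, holding 0 and 1, serve as the addresses of `n` and `d`.
  set 0 1 ∷ load 2 1 ∷ load 3 0 ∷
  copy 12 3 ∷ copy 13 12 ∷ inc 13 ∷ copy 14 13 ∷ inc 14 ∷ copy 15 14 ∷ inc 15 ∷
  -- The first row belongs to hub 0, whose number is `d`. Reading starts behind the two header
  -- cells, writing behind the whole input of 2 + 2 n d cells.
  copy 6 3 ∷ set 4 2 ∷ op mul 5 2 3 ∷ op add 5 5 5 ∷ inc 5 ∷ inc 5 ∷ []

prologue-ok : ∀ {n d M} → let M′ = n ∷ d ∷ M in length M′ ≡ 2 + (n * d + n * d) →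
  Exec prologue (noRegs , M′) (19 + 3 * (n * d)) (writing n d 2 d 0 0 0 0 0 M′)
prologue-ok {n} {d} {M} len = weaken (≤-reflexive cost)
  (cast (cong (λ l → regs n d 2 l d 0 0 0 0 0 , n ∷ d ∷ M) (sym len))
    (set-ok 0 1 ▸ load-ok 2 1 ▸ load-ok 3 0 ▸
     copy-ok 12 3 ▸ copy-ok 13 12 ▸ inc-ok 13 ▸ copy-ok 14 13 ▸ inc-ok 14 ▸ copy-ok 15 14 ▸ inc-ok 15 ▸
     copy-ok 6 3 ▸ set-ok 4 2 ▸ op-ok mul 5 2 3 ▸ op-ok add 5 5 5 ▸ inc-ok 5 ▸ inc-ok 5))
  where
  cost : 15 + (suc (n * d) + (suc (n * d + n * d) + 2)) ≡ 19 + 3 * (n * d)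
  cost = solve 1 (λ x → con 15 :+ (con 1 :+ x :+ (con 1 :+ (x :+ x) :+ con 2)) := con 19 :+ con 3 :* x)
           refl (n * d)

hubRow-ok : ∀ hs {n d ptr v o m M} →
  let us = hubs d hs in
  Exec (endRow hs) (writing n d ptr v 0 0 o 0 m M) (length hs * 5 + 1)
       (writing n d ptr (suc v) 0 0 o 0 (length us + m) (M ++ rowEnc v us))
hubRow-ok hs {d = d} {v = v} {m = m} {M} = sequence (emitHubs-ok hs)
  (cast (writing-cong refl refl (cong (_+ m) (sym (length-map _ hs))) refl) (inc-ok 6))

-- The hubs adjacent to all vectors of A and of B, respectively.
hubsA hubsB : List (Fin 4)
hubsA = # 0 ∷ # 2 ∷ []
hubsB = # 1 ∷ []

-- Every edge is written in the row of its larger endpoint, in the order hubs, A, B of the vertex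
-- numbers. Coordinates have no smaller neighbours, hence no rows.
writeEdges : List (Fin 4) → List (Fin 4) → Program
writeEdges l₂ l₃ =
  fullRow [] ++ fullRow (# 0 ∷ []) ++ endRow l₂ ++ endRow l₃ ++
  (copy 9 2 ∷ vectorRows hubsA) ++ (copy 9 2 ∷ vectorRows hubsB)

module _ {n d : ℕ} (l₂ l₃ : List (Fin 4)) (A B : Vec (Vec Bool d) n) where

  edgesEnc : List ℕ
  edgesEnc =
    rowEnc d (pick 0 (Vec.replicate d true) ++ hubs d []) ++
    rowEnc (1 + d) (pick 0 (Vec.replicate d true) ++ hubs d (# 0 ∷ [])) ++
    rowEnc (2 + d) (hubs d l₂) ++
    rowEnc (3 + d) (hubs d l₃) ++
    rowsEnc hubsA (4 + d) A ++
    rowsEnc hubsB (n + (4 + d)) B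

  edgesCount : ℕ
  edgesCount =
    rowsCount hubsB B + (rowsCount hubsA A + (length (hubs d l₃) + (length (hubs d l₂) +
    (length (pick 0 (Vec.replicate d true) ++ hubs d (# 0 ∷ [])) +
    (length (pick 0 (Vec.replicate d true) ++ hubs d []) + 0)))))

  writeCost : ℕ
  writeCost = (d * 8 + 4 + 0) + ((d * 8 + 4 + 5) + ((length l₂ * 5 + 1) + ((length l₃ * 5 + 1) +
    ((1 + suc (n * (d * 12 + 6 + 10))) + (1 + suc (n * (d * 12 + 6 + 5)))))))

  writeEdges-ok : ∀ M → ReadsRows M 2 A → ReadsRows M (rowsEnd A 2) B →
    Exec (writeEdges l₂ l₃) (writing n d 2 d 0 0 0 0 0 M) writeCost
         (writing n d (rowsEnd B (rowsEnd A 2)) (n + (n + (4 + d))) 0 0 0 0 edgesCount (M ++ edgesEnc))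
  writeEdges-ok M rA rB = cast (writing-cong refl refl refl assoc)
    (sequence (fullRow-ok []) (sequence (fullRow-ok (# 0 ∷ []))
    (sequence (hubRow-ok l₂) (sequence (hubRow-ok l₃)
    (sequence (copy-ok 9 2 ▸ vectorRows-ok hubsA A rA₄)
              (copy-ok 9 2 ▸ vectorRows-ok hubsB B rB₅))))))
    where
    e₀ = rowEnc d (pick 0 (Vec.replicate d true) ++ hubs d [])
    e₁ = rowEnc (1 + d) (pick 0 (Vec.replicate d true) ++ hubs d (# 0 ∷ []))
    e₂ = rowEnc (2 + d) (hubs d l₂)
    e₃ = rowEnc (3 + d) (hubs d l₃)
    e₄ = rowsEnc hubsA (4 + d) A
    e₅ = rowsEnc hubsB (n + (4 + d)) B
    M₁ = M ++ e₀
    M₂ = M₁ ++ e₁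
    M₃ = M₂ ++ e₂
    M₄ = M₃ ++ e₃
    M₅ = M₄ ++ e₄
    extend : ∀ p (X : Vec (Vec Bool d) n) → ReadsRows M p X → ReadsRows M₄ p X
    extend p X r = readsRows-++ M₃ e₃ p X (readsRows-++ M₂ e₂ p X
      (readsRows-++ M₁ e₁ p X (readsRows-++ M e₀ p X r)))
    rA₄ : ReadsRows M₄ 2 A
    rA₄ = extend 2 A rA
    rB₅ : ReadsRows M₅ (rowsEnd A 2) B
    rB₅ = readsRows-++ M₄ e₄ _ B (extend _ B rB)
    assoc : M₅ ++ e₅ ≡ M ++ edgesEnc
    assoc rewrite ++-assoc M₄ e₄ e₅ | ++-assoc M₃ e₃ (e₄ ++ e₅)
                | ++-assoc M₂ e₂ (e₃ ++ e₄ ++ e₅) | ++-assoc M₁ e₁ (e₂ ++ e₃ ++ e₄ ++ e₅)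
                | ++-assoc M e₀ (e₁ ++ e₂ ++ e₃ ++ e₄ ++ e₅) = refl

-- Shifting the memory by 2 n d cells leaves the edges behind two cells for the
-- header.
epilogue : Program
epilogue =
  copy 8 5 ∷ op mul 4 2 3 ∷ op add 4 4 4 ∷ while 8 shiftBody ∷ store 1 6 ∷ store 0 11 ∷
  set 0 0 ∷ set 2 0 ∷ set 3 0 ∷ set 4 0 ∷ set 5 0 ∷ set 6 0 ∷ set 7 0 ∷
  set 11 0 ∷ set 12 0 ∷ set 13 0 ∷ set 14 0 ∷ set 15 0 ∷ []

-- Rows are numbered consecutively, so after the last one register 6 holds the number of vertices,
-- the first header cell. Registers 1, 8, 9 and 10 are 0 already when the others are cleared, so
-- that the next program starts from blank registers.
epilogue-ok : ∀ {n d ptr v m M} →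
  Exec epilogue (writing n d ptr v 0 0 0 0 m M) (18 + 3 * (n * d) + length M * 7)
       (noRegs , put (put (shiftBy (n * d + n * d) M) 0 v) 1 m)
epilogue-ok {n} {d} {ptr} {v} {m} {M} = weaken (≤-reflexive cost)
  (copy-ok 8 5 ▸ op-ok mul 4 2 3 ▸
   cast (cong (λ p → regs n d p (length M) v 0 (length M) 0 0 m , M) (sym (+-identityʳ (n * d + n * d))))
     (op-ok add 4 4 4) ▸
   shift-ok [] M (n * d + n * d) ▸ store-ok 1 6 ▸ store-ok 0 11 ▸
   set-ok 0 0 ▸ set-ok 2 0 ▸ set-ok 3 0 ▸ set-ok 4 0 ▸ set-ok 5 0 ▸ set-ok 6 0 ▸ set-ok 7 0 ▸
   set-ok 11 0 ▸ set-ok 12 0 ▸ set-ok 13 0 ▸ set-ok 14 0 ▸ set-ok 15 0)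
  where
  cost : 1 + (suc (n * d) + (suc (n * d + n * d) + (suc (length M * 7) + 14)))
         ≡ 18 + 3 * (n * d) + length M * 7
  cost = solve 2 (λ x y → con 1 :+ (con 1 :+ x :+ (con 1 :+ (x :+ x) :+ (con 1 :+ y :+ con 14)))
                          := con 18 :+ con 3 :* x :+ y)
           refl (n * d) (length M * 7)

-- The encoded input and the whole building program

rowBits : ∀ {e} → Vec Bool e → List ℕ
rowBits bs = map bit (toList bs)

matrixBits : ∀ {d e} → Vec (Vec Bool d) e → List ℕ
matrixBits X = rowBits (concat X)

matrixBits-∷ : ∀ {d e} (bs : Vec Bool d) (X : Vec (Vec Bool d) e) →
               matrixBits (bs ∷ X) ≡ rowBits bs ++ matrixBits X
matrixBits-∷ bs X = trans (cong (map bit) (toList-++ bs (concat X))) (map-++ bit (toList bs) _)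

length-rowBits : ∀ {e} (bs : Vec Bool e) → length (rowBits bs) ≡ e
length-rowBits []       = refl
length-rowBits (b ∷ bs) = cong suc (length-rowBits bs)

length-matrixBits : ∀ {d e} (X : Vec (Vec Bool d) e) → length (matrixBits X) ≡ e * d
length-matrixBits X = length-rowBits (concat X)

reads-row : ∀ pre {e} (bs : Vec Bool e) post → Reads (pre ++ rowBits bs ++ post) (length pre) bs
reads-row pre []       post = tt
reads-row pre (b ∷ bs) post =
  subst (length pre <_) (sym (length-++ pre)) (m<m+n (length pre) (s≤s z≤n)) ,
  cells-++ʳ pre (bit b ∷ rowBits bs ++ post) 0 ,
  subst₂ (λ M p → Reads M p bs) (++-assoc pre (bit b ∷ []) _) (length-snoc pre (bit b))
    (reads-row (pre ++ bit b ∷ []) bs post)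

reads-matrix : ∀ pre {d e} (X : Vec (Vec Bool d) e) post →
               ReadsRows (pre ++ matrixBits X ++ post) (length pre) X
reads-matrix pre []       post = tt
reads-matrix pre {d} (bs ∷ X) post rewrite matrixBits-∷ bs X | ++-assoc (rowBits bs) (matrixBits X) post =
  reads-row pre bs _ ,
  subst₂ (λ M p → ReadsRows M p X) (++-assoc pre (rowBits bs) _)
    (trans (length-++ pre) (trans (+-comm (length pre) _) (cong (_+ length pre) (length-rowBits bs))))
    (reads-matrix (pre ++ rowBits bs) X post)

rowsEnd≡ : ∀ {d e} (X : Vec (Vec Bool d) e) p → rowsEnd X p ≡ p + e * d
rowsEnd≡ []             p = sym (+-identityʳ p)
rowsEnd≡ {d} (_∷_ {n = e} bs X) p = trans (rowsEnd≡ X (d + p))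
  (trans (cong (_+ e * d) (+-comm d p)) (+-assoc p d (e * d)))

cells-≤ : ∀ {B} xs → (∀ i → cells xs i ≤ B) → ∀ ys → (∀ i → cells ys i ≤ B) →
          ∀ i → cells (xs ++ ys) i ≤ B
cells-≤ []       p ys q i       = q i
cells-≤ (x ∷ xs) p ys q zero    = p 0
cells-≤ (x ∷ xs) p ys q (suc i) = cells-≤ xs (λ j → p (suc j)) ys q i

rowBits-≤ : ∀ {e} (bs : Vec Bool e) i → cells (rowBits bs) i ≤ 1
rowBits-≤ []           i       = z≤n
rowBits-≤ (true ∷ bs)  zero    = ≤-refl
rowBits-≤ (false ∷ bs) zero    = z≤n
rowBits-≤ (b ∷ bs)     (suc i) = rowBits-≤ bs i

-- Lists that differ only in trailing zeros denote the same state. The shifted memory has such zeros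
-- behind the edges, `output` has none.
conv : ∀ {p S S′ S″ c} → ⟦ S′ ⟧ ≈ ⟦ S″ ⟧ → Exec p S c S′ → Exec p S c S″
conv {S″ = S″} S′≈S″ P = exec
  (λ B h → let p , q = bounded P B h in
    (λ r → subst (_≤ B + _) (reg≈ S′≈S″ r) (p r)) , (λ a → subst (_≤ B + _) (mem≈ S′≈S″ a) (q a)))
  λ w B h l σ k σ≈S →
    let t , σ′ , t≤c , σ′≈S′ , e = runs P w B h l σ k σ≈S
    in t , σ′ , t≤c , ≈-trans σ′≈S′ S′≈S″ , e

noRegs≈0 : ∀ r → cells noRegs r ≡ 0
noRegs≈0 r = go 16 r
  where
  go : ∀ m r → cells (replicate m 0) r ≡ 0
  go zero    r       = refl
  go (suc m) zero    = refl
  go (suc m) (suc r) = go m r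

module Build {n d : ℕ} (l₂ l₃ : List (Fin 4)) (A B : Vec (Vec Bool d) n) where

  input : List ℕ
  input = n ∷ d ∷ matrixBits A ++ matrixBits B

  output : List ℕ
  output = n + (n + (4 + d)) ∷ edgesCount l₂ l₃ A B ∷ edgesEnc l₂ l₃ A B

  length-input : length input ≡ 2 + (n * d + n * d)
  length-input = cong (2 +_) (trans (length-++ (matrixBits A))
    (cong₂ _+_ (length-matrixBits A) (length-matrixBits B)))

  input-bounded : Bounded (1 + n + d) (noRegs , input)
  input-bounded = (λ r → subst (_≤ 1 + n + d) (sym (noRegs≈0 r)) z≤n) , bound
    where
    bound : ∀ a → cells input a ≤ 1 + n + d
    bound zero          = ≤-trans (n≤1+n n) (m≤m+n (1 + n) d)
    bound (suc zero)    = m≤n+m d (1 + n)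
    bound (suc (suc a)) = ≤-trans
      (cells-≤ (matrixBits A) (rowBits-≤ (concat A)) _ (rowBits-≤ (concat B)) a) (s≤s z≤n)

  written : Mach
  written = writing n d (rowsEnd B (rowsEnd A 2)) (n + (n + (4 + d))) 0 0 0 0
                    (edgesCount l₂ l₃ A B) (input ++ edgesEnc l₂ l₃ A B)

  writtenCost : ℕ
  writtenCost = 19 + 3 * (n * d) + writeCost l₂ l₃ A B

  written-ok : Exec (prologue ++ writeEdges l₂ l₃) (noRegs , input) writtenCost written
  written-ok = sequence (prologue-ok length-input) (writeEdges-ok l₂ l₃ A B input readsA readsB)
    where
    readsA : ReadsRows input 2 A
    readsA = reads-matrix (n ∷ d ∷ []) A (matrixBits B)
    readsB : ReadsRows input (rowsEnd A 2) B
    readsB = subst₂ (λ M p → ReadsRows M p B)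
      (cong (λ M → n ∷ d ∷ matrixBits A ++ M) (++-identityʳ (matrixBits B)))
      (trans (cong (2 +_) (length-matrixBits A)) (sym (rowsEnd≡ A 2)))
      (reads-matrix (n ∷ d ∷ matrixBits A) B [])

  -- Register 5 holds this length, and the cost also bounds register values. The time of the
  -- shifting loop is thus bounded without counting the edges.
  length-written : length (input ++ edgesEnc l₂ l₃ A B) ≤ 1 + n + d + writtenCost
  length-written = proj₁ (bounded written-ok (1 + n + d) input-bounded) 5

  totalCost : ℕ
  totalCost = writtenCost + (18 + 3 * (n * d) + (1 + n + d + writtenCost) * 7)

  build-exec : Exec ((prologue ++ writeEdges l₂ l₃) ++ epilogue) (noRegs , input) totalCost
                  (noRegs , output)
  build-exec = sequence written-ok
    (conv (pointwise (λ _ → refl) out≗)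
      (weaken (+-monoʳ-≤ (18 + 3 * (n * d)) (*-monoˡ-≤ 7 length-written)) epilogue-ok))
    where
    E = edgesEnc l₂ l₃ A B
    s = n * d + n * d
    D = shiftBy s (input ++ E)
    N = n + (n + (4 + d))
    m = edgesCount l₂ l₃ A B
    out≗ : ∀ a → cells (put (put D 0 N) 1 m) a ≡ cells output a
    out≗ a = trans (sym (cells-put (put D 0 N) 1 m a)) (go a)
      where
      go : ∀ a → (cells (put D 0 N) [ 1 ↦ m ]) a ≡ cells output a
      go zero          = sym (cells-put D 0 N 0)
      go (suc zero)    = refl
      -- The offset 2 of the edges and the shift by 2 n d add up to the length of the input, so the
      -- cells read lie just behind it.
      go (suc (suc a)) = begin
        cells (put D 0 N) (2 + a)          ≡⟨ sym (cells-put D 0 N (2 + a)) ⟩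
        cells D (2 + a)                    ≡⟨ cells-shiftBy s (input ++ E) (2 + a) ⟩
        cells (input ++ E) (2 + a + s)
          ≡⟨ cong (cells (input ++ E)) (trans (cong suc (sym (+-suc a s))) (sym (+-suc a (suc s)))) ⟩
        cells (input ++ E) (a + (2 + s))
          ≡⟨ cong (λ l → cells (input ++ E) (a + l)) (sym length-input) ⟩
        cells (input ++ E) (a + length input) ≡⟨ cells-++ʳ input E a ⟩
        cells E a ∎
        where open ≡-Reasoning

  -- Opaque, as conversion checking would otherwise unfold large sums.
  opaque
    buildCost : ℕ
    buildCost = totalCost

    build-ok : Exec ((prologue ++ writeEdges l₂ l₃) ++ epilogue) (noRegs , input) buildCost
                    (noRegs , output)
    build-ok = build-exec

-- The graph

select : ∀ {X : Set} {e} → (Fin e → X) → Vec Bool e → List X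
select f []           = []
select f (true ∷ bs)  = f fzero ∷ select (f ∘ fsuc) bs
select f (false ∷ bs) = select (f ∘ fsuc) bs

select-∈⁺ : ∀ {X : Set} {e} (f : Fin e → X) bs j → j Subset.∈ bs → f j ∈ select f bs
select-∈⁺ f (true ∷ bs)  fzero    _             = here refl
select-∈⁺ f (true ∷ bs)  (fsuc j) (Vec.there p) = there (select-∈⁺ (f ∘ fsuc) bs j p)
select-∈⁺ f (false ∷ bs) (fsuc j) (Vec.there p) = select-∈⁺ (f ∘ fsuc) bs j p

select-∈⁻ : ∀ {X : Set} {e} (f : Fin e → X) bs {x} → x ∈ select f bs →
            ∃[ j ] x ≡ f j × j Subset.∈ bs
select-∈⁻ f (true ∷ bs)  (here refl) = fzero , refl , Vec.here
select-∈⁻ f (true ∷ bs)  (there p) with select-∈⁻ (f ∘ fsuc) bs p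
... | j , eq₁ , q = fsuc j , eq₁ , Vec.there q
select-∈⁻ f (false ∷ bs) p with select-∈⁻ (f ∘ fsuc) bs p
... | j , eq₁ , q = fsuc j , eq₁ , Vec.there q

select-unique : ∀ {X : Set} {e} (f : Fin e → X) → (∀ {i j} → f i ≡ f j → i ≡ j) →
                ∀ bs → Unique (select f bs)
select-unique f inj []           = []
select-unique f inj (true ∷ bs)  =
  All.tabulate (λ {x} x∈ f0≡x → new x x∈ f0≡x) ∷
  select-unique (f ∘ fsuc) (λ e → fsuc-injective (inj e)) bs
  where
  new : ∀ x → x ∈ select (f ∘ fsuc) bs → f fzero ≡ x → ⊥
  new x x∈ f0≡x with select-∈⁻ (f ∘ fsuc) bs x∈
  ... | j , x≡ , _ with inj (trans f0≡x x≡)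
  ... | ()
select-unique f inj (false ∷ bs) = select-unique (f ∘ fsuc) (λ e → fsuc-injective (inj e)) bs

map-select : ∀ {X : Set} {e} (g : X → ℕ) (f : Fin e → X) j → (∀ i → g (f i) ≡ toℕ i + j) →
             ∀ bs → map g (select f bs) ≡ pick j bs
map-select g f j h []           = refl
map-select g f j h (true ∷ bs)  =
  cong₂ _∷_ (h fzero)
    (map-select g (f ∘ fsuc) (suc j) (λ i → trans (h (fsuc i)) (sym (+-suc (toℕ i) j))) bs)
map-select g f j h (false ∷ bs) =
  map-select g (f ∘ fsuc) (suc j) (λ i → trans (h (fsuc i)) (sym (+-suc (toℕ i) j))) bs

-- The edges from the hubs 2 and 3 to smaller hubs.
record Gadget : Set where
  field
    l₂ l₃    : List (Fin 4)
    ordered₂ : All (λ h → toℕ h < 2) l₂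
    ordered₃ : All (λ h → toℕ h < 3) l₃
    unique₂  : Unique l₂
    unique₃  : Unique l₃

data Vertex (n d : ℕ) : Set where
  coord     : Fin d → Vertex n d
  hub       : Fin 4 → Vertex n d
  vecA vecB : Fin n → Vertex n d

order : ℕ → ℕ → ℕ
order n d = (d + 4) + (n + n)

-- Coordinates and hubs come first: they form the vertex cover, which `StarDecomposition` expects as
-- an initial segment, and they contain all smaller neighbours of every vertex.
index : ∀ {n d} → Vertex n d → Fin (order n d)
index {n} {d} (coord j) = (j ↑ˡ 4) ↑ˡ (n + n)
index {n} {d} (hub h)   = (d ↑ʳ h) ↑ˡ (n + n)
index {n} {d} (vecA i)  = (d + 4) ↑ʳ (i ↑ˡ n)
index {n} {d} (vecB i)  = (d + 4) ↑ʳ (n ↑ʳ i)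

unsplit : ∀ n d → (Fin (d + 4) ⊎ Fin (n + n)) → Vertex n d
unsplit n d (inj₁ c) = [ coord , hub ]′ (splitAt d c)
unsplit n d (inj₂ i) = [ vecA , vecB ]′ (splitAt n i)

vertex : ∀ {n d} → Fin (order n d) → Vertex n d
vertex {n} {d} k = unsplit n d (splitAt (d + 4) k)

vertex-index : ∀ {n d} (v : Vertex n d) → vertex (index v) ≡ v
vertex-index {n} {d} (coord j)
  rewrite splitAt-↑ˡ (d + 4) (j ↑ˡ 4) (n + n) | splitAt-↑ˡ d j 4 = refl
vertex-index {n} {d} (hub h)
  rewrite splitAt-↑ˡ (d + 4) (d ↑ʳ h) (n + n) | splitAt-↑ʳ d 4 h = refl
vertex-index {n} {d} (vecA i)
  rewrite splitAt-↑ʳ (d + 4) (n + n) (i ↑ˡ n) | splitAt-↑ˡ n i n = refl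
vertex-index {n} {d} (vecB i)
  rewrite splitAt-↑ʳ (d + 4) (n + n) (n ↑ʳ i) | splitAt-↑ʳ n n i = refl

index-injective : ∀ {n d} {u v : Vertex n d} → index u ≡ index v → u ≡ v
index-injective {u = u} {v} e = trans (sym (vertex-index u)) (trans (cong vertex e) (vertex-index v))

index-vertex : ∀ {n d} (k : Fin (order n d)) → index (vertex {n} {d} k) ≡ k
index-vertex {n} {d} k with splitAt (d + 4) k in e
... | inj₁ c with splitAt d c in e′
...   | inj₁ j = trans (cong (_↑ˡ (n + n)) (splitAt⁻¹-↑ˡ e′)) (splitAt⁻¹-↑ˡ e)
...   | inj₂ h = trans (cong (_↑ˡ (n + n)) (splitAt⁻¹-↑ʳ e′)) (splitAt⁻¹-↑ˡ e)
index-vertex {n} {d} k | inj₂ i with splitAt n i in e′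
...   | inj₁ j = trans (cong ((d + 4) ↑ʳ_) (splitAt⁻¹-↑ˡ e′)) (splitAt⁻¹-↑ʳ e)
...   | inj₂ j = trans (cong ((d + 4) ↑ʳ_) (splitAt⁻¹-↑ʳ e′)) (splitAt⁻¹-↑ʳ e)

rank : ∀ {n d} → Vertex n d → ℕ
rank v = toℕ (index v)

rank-coord : ∀ n d (j : Fin d) → rank {n} (coord j) ≡ toℕ j
rank-coord n d j = trans (toℕ-↑ˡ (j ↑ˡ 4) (n + n)) (toℕ-↑ˡ j 4)

rank-hub : ∀ n d (h : Fin 4) → rank {n} {d} (hub h) ≡ toℕ h + d
rank-hub n d h = trans (toℕ-↑ˡ (d ↑ʳ h) (n + n)) (trans (toℕ-↑ʳ d h) (+-comm d (toℕ h)))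

rank-vecA : ∀ n d (i : Fin n) → rank {n} {d} (vecA i) ≡ toℕ i + (4 + d)
rank-vecA n d i = trans (toℕ-↑ʳ (d + 4) (i ↑ˡ n))
  (trans (cong₂ _+_ (+-comm d 4) (toℕ-↑ˡ i n)) (+-comm (4 + d) (toℕ i)))

rank-vecB : ∀ n d (i : Fin n) → rank {n} {d} (vecB i) ≡ toℕ i + (n + (4 + d))
rank-vecB n d i = trans (toℕ-↑ʳ (d + 4) (n ↑ʳ i)) (trans (cong₂ _+_ (+-comm d 4) (toℕ-↑ʳ n i))
  (trans (+-comm (4 + d) (n + toℕ i))
    (trans (cong (_+ (4 + d)) (+-comm n (toℕ i))) (+-assoc (toℕ i) n (4 + d)))))

encodeEdges : ∀ {N} → List (Fin N × Fin N) → List ℕ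
encodeEdges = concatMap (λ (u , v) → toℕ u ∷ toℕ v ∷ [])

length-encodeEdges : ∀ {N} (es : List (Fin N × Fin N)) → length (encodeEdges es) ≡ length es * 2
length-encodeEdges []       = refl
length-encodeEdges (e ∷ es) = cong (2 +_) (length-encodeEdges es)

length-rowEnc : ∀ v us → length (rowEnc v us) ≡ length us * 2
length-rowEnc v []       = refl
length-rowEnc v (u ∷ us) = cong (2 +_) (length-rowEnc v us)

length-rowsEnc : ∀ hs v {d e} (X : Vec (Vec Bool d) e) → length (rowsEnc hs v X) ≡ rowsCount hs X * 2
length-rowsEnc hs v []       = refl
length-rowsEnc hs v {d} (bs ∷ X) = trans (length-++ (rowEnc v us))
  (trans (cong₂ _+_ (length-rowEnc v us) (length-rowsEnc hs (suc v) X))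
    (trans (+-comm (length us * 2) _) (sym (*-distribʳ-+ 2 (rowsCount hs X) (length us)))))
  where us = pick 0 bs ++ hubs d hs

Core : ∀ {n d} → Vertex n d → Set
Core (coord _) = ⊤
Core (hub _)   = ⊤
Core (vecA _)  = ⊥
Core (vecB _)  = ⊥

core-index : ∀ {n d} (u : Vertex n d) → Core u → Σ[ c ∈ Fin (d + 4) ] index u ≡ c ↑ˡ (n + n)
core-index (coord j) _ = _ , refl
core-index (hub h)   _ = _ , refl

module Construction (Γ : Gadget) {n d : ℕ} (A B : Vec (Vec Bool d) n) where

  open Gadget Γ

  coords : List (Vertex n d)
  coords = select coord (Vec.replicate d true)

  -- The neighbours of smaller index.
  low : Vertex n d → List (Vertex n d)
  low (coord _)                     = []
  low (hub fzero)                   = coords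
  low (hub (fsuc fzero))            = coords ++ hub (# 0) ∷ []
  low (hub (fsuc (fsuc fzero)))     = map hub l₂
  low (hub (fsuc (fsuc (fsuc _))))  = map hub l₃
  low (vecA i)                      = select coord (lookup A i) ++ map hub hubsA
  low (vecB i)                      = select coord (lookup B i) ++ map hub hubsB

  vertices : List (Vertex n d)
  vertices = map hub (allFin 4) ++ tabulate vecA ++ tabulate vecB

  row : Vertex n d → List (Fin (order n d) × Fin (order n d))
  row v = map (λ u → index u , index v) (low v)

  graphEdges : List (Fin (order n d) × Fin (order n d))
  graphEdges = concatMap row vertices

  ∈-rows⁻ : ∀ vs {p} → p ∈ concatMap row vs → ∃[ v ] v ∈ vs × p ∈ row v
  ∈-rows⁻ (v ∷ vs) p∈ with ∈-++⁻ (row v) p∈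
  ... | inj₁ q = v , here refl , q
  ... | inj₂ q with ∈-rows⁻ vs q
  ... | v′ , v′∈ , q′ = v′ , there v′∈ , q′

  ∈-rows⁺ : ∀ vs {p v} → v ∈ vs → p ∈ row v → p ∈ concatMap row vs
  ∈-rows⁺ (v ∷ vs) (here refl) q = ∈-++⁺ˡ q
  ∈-rows⁺ (v ∷ vs) (there v∈) q  = ∈-++⁺ʳ (row v) (∈-rows⁺ vs v∈ q)

  coords-< : ∀ (v : Vertex n d) bs → d ≤ rank v → All (λ u → rank u < rank v) (select (coord {n} {d}) bs)
  coords-< v bs d≤v = All.tabulate {P = λ u → rank u < rank v} λ {u} u∈ → below u u∈
    where
    below : ∀ u → u ∈ select coord bs → rank u < rank v
    below u u∈ with select-∈⁻ coord bs u∈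
    ... | j , refl , _ = ≤-trans (s≤s (≤-reflexive (rank-coord n d j))) (≤-trans (toℕ<n j) d≤v)

  hubs-< : ∀ (v : Vertex n d) {m} hs → All (λ h → toℕ h < m) hs → m + d ≤ rank v →
           All (λ u → rank {n} {d} u < rank v) (map hub hs)
  hubs-< v {m} hs all m≤v = AllP.map⁺ {f = hub} (All.map {Q = λ h → rank (hub {n} {d} h) < rank v}
    (λ {h} h<m → ≤-trans (s≤s (≤-reflexive (rank-hub n d h))) (≤-trans (+-monoˡ-≤ d h<m) m≤v)) all)

  low-< : ∀ v → All (λ u → rank u < rank v) (low v)
  low-< (coord _) = []
  low-< v@(hub fzero) = coords-< v (Vec.replicate d true) (≤-reflexive (sym (rank-hub n d (# 0))))
  low-< v@(hub (fsuc fzero)) = AllP.++⁺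
    (coords-< v (Vec.replicate d true)
      (≤-trans (m≤n+m d 1) (≤-reflexive (sym (rank-hub n d (# 1))))))
    (hubs-< v {m = 1} (# 0 ∷ []) (s≤s z≤n ∷ []) (≤-reflexive (sym (rank-hub n d (# 1)))))
  low-< v@(hub (fsuc (fsuc fzero))) =
    hubs-< v l₂ ordered₂ (≤-reflexive (sym (rank-hub n d (# 2))))
  low-< v@(hub (fsuc (fsuc (fsuc fzero)))) =
    hubs-< v l₃ ordered₃ (≤-reflexive (sym (rank-hub n d (# 3))))
  low-< (vecA i) = AllP.++⁺
    (coords-< (vecA i) (lookup A i) (≤-trans (m≤n+m d 4) 4+d≤))
    (hubs-< (vecA i) {m = 4} hubsA (s≤s z≤n ∷ s≤s (s≤s (s≤s z≤n)) ∷ []) 4+d≤)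
    where 4+d≤ = ≤-trans (m≤n+m (4 + d) (toℕ i)) (≤-reflexive (sym (rank-vecA n d i)))
  low-< (vecB i) = AllP.++⁺
    (coords-< (vecB i) (lookup B i) (≤-trans (m≤n+m d 4) 4+d≤))
    (hubs-< (vecB i) {m = 4} hubsB (s≤s (s≤s z≤n) ∷ []) 4+d≤)
    where 4+d≤ = ≤-trans (≤-trans (m≤n+m (4 + d) n) (m≤n+m (n + (4 + d)) (toℕ i)))
                         (≤-reflexive (sym (rank-vecB n d i)))

  rows-ordered : ∀ vs → All (λ (u , v) → u Fin.< v) (concatMap row vs)
  rows-ordered []       = []
  rows-ordered (v ∷ vs) = AllP.++⁺ (AllP.map⁺ (low-< v)) (rows-ordered vs)

  coord-injective : ∀ {i j} → coord {n} {d} i ≡ coord j → i ≡ j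
  coord-injective refl = refl

  hub-injective : ∀ {i j} → hub {n} {d} i ≡ hub j → i ≡ j
  hub-injective refl = refl

  mixed-unique : ∀ bs hs → Unique hs → Unique (select (coord {n} {d}) bs ++ map hub hs)
  mixed-unique bs hs uniq = Unique.++⁺ (select-unique coord coord-injective bs)
    (Unique.map⁺ hub-injective uniq) λ (p , q) → disjoint p q
    where
    disjoint : ∀ {x} → x ∈ select (coord {n} {d}) bs → x ∈ map hub hs → ⊥
    disjoint p q with select-∈⁻ coord bs p | ∈-map⁻ hub q
    ... | _ , refl , _ | _ , _ , ()

  low-unique : ∀ v → Unique (low v)
  low-unique (coord _)                        = []
  low-unique (hub fzero)                      = select-unique coord coord-injective (Vec.replicate d true)
  low-unique (hub (fsuc fzero))               = mixed-unique (Vec.replicate d true) (# 0 ∷ []) ([] ∷ [])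
  low-unique (hub (fsuc (fsuc fzero)))        = Unique.map⁺ hub-injective unique₂
  low-unique (hub (fsuc (fsuc (fsuc fzero)))) = Unique.map⁺ hub-injective unique₃
  low-unique (vecA i) = mixed-unique (lookup A i) hubsA (((λ ()) ∷ []) ∷ [] ∷ [])
  low-unique (vecB i) = mixed-unique (lookup B i) hubsB ([] ∷ [])

  vertices-unique : Unique vertices
  vertices-unique = Unique.++⁺ (Unique.map⁺ hub-injective (Unique.allFin⁺ 4))
    (Unique.++⁺ (Unique.tabulate⁺ (λ { refl → refl })) (Unique.tabulate⁺ (λ { refl → refl }))
      λ (p , q) → AB p q)
    λ (p , q) → hubVec p (∈-++⁻ (tabulate vecA) q)
    where
    AB : ∀ {x} → x ∈ tabulate vecA → x ∈ tabulate vecB → ⊥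
    AB p q with ∈-tabulate⁻ {f = vecA} p | ∈-tabulate⁻ {f = vecB} q
    ... | _ , refl | _ , ()
    hubVec : ∀ {x} → x ∈ map hub (allFin 4) → x ∈ tabulate vecA ⊎ x ∈ tabulate vecB → ⊥
    hubVec p (inj₁ q) with ∈-map⁻ hub p | ∈-tabulate⁻ {f = vecA} q
    ... | _ , _ , refl | _ , ()
    hubVec p (inj₂ q) with ∈-map⁻ hub p | ∈-tabulate⁻ {f = vecB} q
    ... | _ , _ , refl | _ , ()

  -- Edges of different rows differ in their second endpoint, edges of one row in their first.
  rows-unique : ∀ vs → Unique vs → Unique (concatMap row vs)
  rows-unique []       _          = []
  rows-unique (v ∷ vs) (v∉ ∷ uniq) = Unique.++⁺
    (Unique.map⁺ (λ {u} {u′} e → index-injective {u = u} {u′} (cong proj₁ e)) (low-unique v))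
    (rows-unique vs uniq)
    λ (p , q) → disjoint p q
    where
    disjoint : ∀ {x} → x ∈ row v → x ∈ concatMap row vs → ⊥
    disjoint p q with ∈-map⁻ _ p | ∈-rows⁻ vs q
    ... | _ , _ , refl | v′ , v′∈ , r with ∈-map⁻ _ r
    ... | _ , _ , e = All.lookup v∉ v′∈ (index-injective {u = v} {v′} (cong proj₂ e))

  graph : Graph (order n d)
  graph = record
    { edges   = graphEdges
    ; ordered = rows-ordered vertices
    ; unique  = rows-unique vertices vertices-unique
    }

  infix 4 _~_

  _~_ : Vertex n d → Vertex n d → Set
  u ~ v = u ∈ low v ⊎ v ∈ low u

  ∈-vertices : ∀ u v → u ∈ low v → v ∈ vertices
  ∈-vertices u (hub h)  _ = ∈-++⁺ˡ (∈-map⁺ hub (∈-tabulate⁺ {f = λ i → i} h))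
  ∈-vertices u (vecA i) _ = ∈-++⁺ʳ (map hub (allFin 4)) (∈-++⁺ˡ (∈-tabulate⁺ {f = vecA} i))
  ∈-vertices u (vecB i) _ = ∈-++⁺ʳ (map hub (allFin 4)) (∈-++⁺ʳ (tabulate vecA) (∈-tabulate⁺ {f = vecB} i))

  ∈-edges⁺ : ∀ u v → u ∈ low v → (index u , index v) ∈ graphEdges
  ∈-edges⁺ u v u∈ = ∈-rows⁺ vertices (∈-vertices u v u∈) (∈-map⁺ _ u∈)

  ∈-edges⁻ : ∀ u v → (index u , index v) ∈ graphEdges → u ∈ low v
  ∈-edges⁻ u v p with ∈-rows⁻ vertices p
  ... | v′ , _ , q with ∈-map⁻ _ q
  ... | u′ , u′∈ , e =
    subst₂ (λ x y → x ∈ low y) (sym (index-injective {u = u} {u′} (cong proj₁ e)))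
                               (sym (index-injective {u = v} {v′} (cong proj₂ e))) u′∈

  ~⇒Adj : ∀ {u v} → u ~ v → Adj graph (index u) (index v)
  ~⇒Adj {u} {v} (inj₁ p) = inj₁ (∈-edges⁺ u v p)
  ~⇒Adj {u} {v} (inj₂ p) = inj₂ (∈-edges⁺ v u p)

  Adj⇒~ : ∀ u v → Adj graph (index u) (index v) → u ~ v
  Adj⇒~ u v (inj₁ p) = inj₁ (∈-edges⁻ u v p)
  Adj⇒~ u v (inj₂ p) = inj₂ (∈-edges⁻ v u p)

  mixed-∈⁻ : ∀ bs hs {u} → u ∈ select (coord {n} {d}) bs ++ map hub hs →
             (∃[ j ] u ≡ coord j × j Subset.∈ bs) ⊎ (∃[ h ] u ≡ hub h × h ∈ hs)
  mixed-∈⁻ bs hs u∈ with ∈-++⁻ (select coord bs) u∈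
  ... | inj₁ p = inj₁ (select-∈⁻ coord bs p)
  ... | inj₂ p with ∈-map⁻ hub p
  ... | h , h∈ , refl = inj₂ (h , refl , h∈)

  mixed-core : ∀ bs hs {u} → u ∈ select coord bs ++ map hub hs → Core u
  mixed-core bs hs u∈ with mixed-∈⁻ bs hs u∈
  ... | inj₁ (_ , refl , _) = tt
  ... | inj₂ (_ , refl , _) = tt

  hubs-core : ∀ hs {u} → u ∈ map (hub {n} {d}) hs → Core u
  hubs-core hs u∈ with ∈-map⁻ hub u∈
  ... | _ , _ , refl = tt

  low-core : ∀ v {u} → u ∈ low v → Core u
  low-core (hub fzero) u∈                      with select-∈⁻ coord (Vec.replicate d true) u∈
  ... | _ , refl , _ = tt
  low-core (hub (fsuc fzero)) u∈               = mixed-core (Vec.replicate d true) (# 0 ∷ []) u∈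
  low-core (hub (fsuc (fsuc fzero))) u∈        = hubs-core l₂ u∈
  low-core (hub (fsuc (fsuc (fsuc fzero)))) u∈ = hubs-core l₃ u∈
  low-core (vecA i) u∈                         = mixed-core (lookup A i) hubsA u∈
  low-core (vecB i) u∈                         = mixed-core (lookup B i) hubsB u∈

  encode-row : ∀ v → encodeEdges (row v) ≡ rowEnc (rank v) (map rank (low v))
  encode-row v = go (low v)
    where
    go : ∀ us → encodeEdges (map (λ u → index u , index v) us) ≡ rowEnc (rank v) (map rank us)
    go []       = refl
    go (u ∷ us) = cong (λ l → rank u ∷ rank v ∷ l) (go us)

  encode-row-++ : ∀ v es → encodeEdges (row v ++ es) ≡ rowEnc (rank v) (map rank (low v)) ++ encodeEdges es
  encode-row-++ v es = trans (concatMap-++ _ (row v) es) (cong (_++ encodeEdges es) (encode-row v))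

  rank-hubs : ∀ hs → map rank (map (hub {n} {d}) hs) ≡ hubs d hs
  rank-hubs hs = trans (sym (map-∘ hs)) (map-cong (rank-hub n d) hs)

  rank-mixed : ∀ bs hs → map rank (select (coord {n} {d}) bs ++ map hub hs) ≡ pick 0 bs ++ hubs d hs
  rank-mixed bs hs = trans (map-++ rank (select coord bs) (map hub hs))
    (cong₂ _++_ (map-select rank coord 0 (λ i → trans (rank-coord n d i) (sym (+-identityʳ (toℕ i)))) bs)
                (rank-hubs hs))

  -- Stated for an arbitrary family `f`, since the recursion drops vectors from `X` and shifts `f`,
  -- while `vecA` and `vecB` refer to the fixed lists `A` and `B`.
  encode-vectors : ∀ hs {e} (X : Vec (Vec Bool d) e) v (f : Fin e → Vertex n d) →
    (∀ i → low (f i) ≡ select coord (lookup X i) ++ map hub hs) →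
    (∀ i → rank (f i) ≡ toℕ i + v) →
    encodeEdges (concatMap row (tabulate f)) ≡ rowsEnc hs v X
  encode-vectors hs []       v f low≡ rank≡ = refl
  encode-vectors hs (bs ∷ X) v f low≡ rank≡ = trans (encode-row-++ (f fzero) _)
    (cong₂ _++_
      (cong₂ rowEnc (rank≡ fzero) (trans (cong (map rank) (low≡ fzero)) (rank-mixed bs hs)))
      (encode-vectors hs X (suc v) (f ∘ fsuc) (λ i → low≡ (fsuc i))
        (λ i → trans (rank≡ (fsuc i)) (sym (+-suc (toℕ i) v)))))

  encode-edges : encodeEdges graphEdges ≡ edgesEnc l₂ l₃ A B
  encode-edges =
    trans (encode-row-++ (hub (# 0)) _) (cong₂ _++_
      (cong₂ rowEnc (rank-hub n d (# 0))
        (trans (cong (map rank) (sym (++-identityʳ coords))) (rank-mixed (Vec.replicate d true) [])))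
    (trans (encode-row-++ (hub (# 1)) _) (cong₂ _++_
      (cong₂ rowEnc (rank-hub n d (# 1)) (rank-mixed (Vec.replicate d true) (# 0 ∷ [])))
    (trans (encode-row-++ (hub (# 2)) _) (cong₂ _++_
      (cong₂ rowEnc (rank-hub n d (# 2)) (rank-hubs l₂))
    (trans (encode-row-++ (hub (# 3)) _) (cong₂ _++_
      (cong₂ rowEnc (rank-hub n d (# 3)) (rank-hubs l₃))
    (trans (cong encodeEdges (concatMap-++ row (tabulate vecA) (tabulate vecB)))
    (trans (concatMap-++ _ (concatMap row (tabulate vecA)) _) (cong₂ _++_
      (encode-vectors hubsA A (4 + d) vecA (λ _ → refl) (rank-vecA n d))
      (encode-vectors hubsB B (n + (4 + d)) vecB (λ _ → refl) (rank-vecB n d))))))))))))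

  length-edgesEnc : length (edgesEnc l₂ l₃ A B) ≡ edgesCount l₂ l₃ A B * 2
  length-edgesEnc = trans
    (split d u₀ (split (1 + d) u₁ (split (2 + d) u₂ (split (3 + d) u₃
      (trans (length-++ (rowsEnc hubsA (4 + d) A))
        (cong₂ _+_ (length-rowsEnc hubsA (4 + d) A) (length-rowsEnc hubsB (n + (4 + d)) B)))))))
    (solve 6 (λ a b c x y z →
        a :* con 2 :+ (b :* con 2 :+ (c :* con 2 :+ (x :* con 2 :+ (y :* con 2 :+ z :* con 2))))
        := (z :+ (y :+ (x :+ (c :+ (b :+ (a :+ con 0)))))) :* con 2)
        refl (length u₀) (length u₁) (length u₂) (length u₃) (rowsCount hubsA A) (rowsCount hubsB B))
    where
    u₀ = pick 0 (Vec.replicate d true) ++ hubs d []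
    u₁ = pick 0 (Vec.replicate d true) ++ hubs d (# 0 ∷ [])
    u₂ = hubs d l₂
    u₃ = hubs d l₃
    split : ∀ v us {es m} → length es ≡ m → length (rowEnc v us ++ es) ≡ length us * 2 + m
    split v us len = trans (length-++ (rowEnc v us)) (cong₂ _+_ (length-rowEnc v us) len)

  -- Both counts are compared through the common encoding, where each edge takes two cells; then the
  -- factor 2 is cancelled.
  length-edges : length graphEdges ≡ edgesCount l₂ l₃ A B
  length-edges = *-cancelʳ-≡ (length graphEdges) _ 2
    (trans (sym (length-encodeEdges graphEdges)) (trans (cong length encode-edges) length-edgesEnc))

  order≡ : order n d ≡ n + (n + (4 + d))
  order≡ = trans (cong (_+ (n + n)) (+-comm d 4)) (trans (+-comm (4 + d) (n + n)) (+-assoc n n (4 + d)))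

  encode-graph : encodeGraph graph ≡ Build.output l₂ l₃ A B
  encode-graph = cong₂ _∷_ order≡ (cong₂ _∷_ length-edges encode-edges)

-- Treewidth

starGraph : ∀ m → Graph (suc m)
starGraph m = record
  { edges   = map (λ i → fzero , fsuc i) (allFin m)
  ; ordered = AllP.map⁺ (All.tabulate λ _ → s≤s z≤n)
  ; unique  = Unique.map⁺ (λ { refl → refl }) (Unique.allFin⁺ m)
  }

center-adj : ∀ {m} (i : Fin m) → Adj (starGraph m) fzero (fsuc i)
center-adj i = inj₁ (∈-map⁺ _ (∈-tabulate⁺ {f = id} i))

adj-center : ∀ {m} (i : Fin m) → Adj (starGraph m) (fsuc i) fzero
adj-center i = inj₂ (∈-map⁺ _ (∈-tabulate⁺ {f = id} i))

one-center : ∀ {m} {a b : Fin (suc m)} → Adj (starGraph m) a b → a ≡ fzero ⊎ b ≡ fzero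
one-center (inj₁ p) with ∈-map⁻ _ p
... | _ , _ , refl = inj₁ refl
one-center (inj₂ p) with ∈-map⁻ _ p
... | _ , _ , refl = inj₂ refl

-- Every edge contains the centre, so two consecutive edges of a cycle force their shared vertex `v`
-- to be the centre. The edge that leaves `w` next avoids `v`, a contradiction.
starGraph-acyclic : ∀ m → ¬ HasCycle (starGraph m)
starGraph-acyclic m (u , v , w , vs , ((u≢v ∷ u≢w ∷ u∉vs) ∷ (v≢w ∷ v∉vs) ∷ _) , (uv ∷ vw ∷ rest))
  with one-center uv | one-center vw
... | inj₁ u≡0 | inj₁ v≡0 = u≢v (trans u≡0 (sym v≡0))
... | inj₁ u≡0 | inj₂ w≡0 = u≢w (trans u≡0 (sym w≡0))
... | inj₂ v≡0 | _ = closing vs rest v∉vs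
  where
  w-x-apart : ∀ {x} → v ≢ x → Adj (starGraph m) w x → ⊥
  w-x-apart v≢x wx with one-center wx
  ... | inj₁ w≡0 = v≢w (trans v≡0 (sym w≡0))
  ... | inj₂ x≡0 = v≢x (trans v≡0 (sym x≡0))
  closing : ∀ vs → Linked (Adj (starGraph m)) (w ∷ vs ++ u ∷ []) → All (v ≢_) vs → ⊥
  closing []       (wu ∷ _) _         = w-x-apart (u≢v ∘ sym) wu
  closing (x ∷ vs) (wx ∷ _) (v≢x ∷ _) = w-x-apart v≢x wx

starGraph-tree : ∀ m → IsTree (starGraph m)
starGraph-tree m = (λ u v → toCenter u ◅◅ fromCenter v) , starGraph-acyclic m
  where
  toCenter : ∀ u → Walk (starGraph m) u fzero
  toCenter fzero    = stop
  toCenter (fsuc i) = adj-center i ◅ stop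
  fromCenter : ∀ v → Walk (starGraph m) fzero v
  fromCenter fzero    = stop
  fromCenter (fsuc i) = center-adj i ◅ stop

∈-++ˡ : ∀ {k m} {p : Subset k} {q : Subset m} {c} → c Subset.∈ p → (c ↑ˡ m) Subset.∈ p Vec.++ q
∈-++ˡ Vec.here      = Vec.here
∈-++ˡ (Vec.there h) = Vec.there (∈-++ˡ h)

∈-++ʳ : ∀ {k m} (p : Subset k) {q : Subset m} {i} → i Subset.∈ q → (k ↑ʳ i) Subset.∈ p Vec.++ q
∈-++ʳ []      h = h
∈-++ʳ (b ∷ p) h = Vec.there (∈-++ʳ p h)

∈-++ʳ⁻ : ∀ {k m} (p : Subset k) {q : Subset m} {i} → (k ↑ʳ i) Subset.∈ p Vec.++ q → i Subset.∈ q
∈-++ʳ⁻ []      h             = h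
∈-++ʳ⁻ (b ∷ p) (Vec.there h) = ∈-++ʳ⁻ p h

∣++∣ : ∀ {k m} (p : Subset k) (q : Subset m) → ∣ p Vec.++ q ∣ ≡ ∣ p ∣ + ∣ q ∣
∣++∣ []          q = refl
∣++∣ (true ∷ p)  q = cong suc (∣++∣ p q)
∣++∣ (false ∷ p) q = ∣++∣ p q

-- A vertex set K meeting every edge, where K consists of the first k vertices:
-- the star whose bags are K and K plus one further vertex.
module StarDecomposition {k m : ℕ} (G : Graph (k + m))
  (meets : ∀ u v → (u , v) ∈ edges G → Σ[ c ∈ Fin k ] u ≡ c ↑ˡ m) where

  bags : Fin (suc m) → Subset (k + m)
  bags fzero    = Subset.⊤ {k} Vec.++ Subset.⊥ {m}
  bags (fsuc i) = Subset.⊤ {k} Vec.++ ⁅ i ⁆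

  core∈bags : ∀ c s → (c ↑ˡ m) Subset.∈ bags s
  core∈bags c fzero    = ∈-++ˡ {p = Subset.⊤} ∈⊤
  core∈bags c (fsuc i) = ∈-++ˡ {p = Subset.⊤} ∈⊤

  rest∈bags⁻ : ∀ i s → (k ↑ʳ i) Subset.∈ bags s → s ≡ fsuc i
  rest∈bags⁻ i fzero    h = ⊥-elim (∉⊥ (∈-++ʳ⁻ (Subset.⊤ {k}) h))
  rest∈bags⁻ i (fsuc j) h = cong fsuc (sym (x∈⁅y⁆⇒x≡y j (∈-++ʳ⁻ (Subset.⊤ {k}) h)))

  covered : ∀ v → ∃[ s ] v Subset.∈ bags s
  covered v with splitAt k v in e
  ... | inj₁ c = fzero , subst (Subset._∈ bags fzero) (splitAt⁻¹-↑ˡ e) (core∈bags c fzero)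
  ... | inj₂ i = fsuc i ,
    subst (Subset._∈ bags (fsuc i)) (splitAt⁻¹-↑ʳ e) (∈-++ʳ (Subset.⊤ {k}) (x∈⁅x⁆ i))

  -- K lies in every bag, so any bag with the other endpoint contains the edge.
  coveredEdge : ∀ u v → Adj G u v → ∃[ s ] u Subset.∈ bags s × v Subset.∈ bags s
  coveredEdge u v (inj₁ p) with meets u v p | covered v
  ... | c , refl | s , v∈ = s , core∈bags c s , v∈
  coveredEdge u v (inj₂ p) with meets v u p | covered u
  ... | c , refl | s , u∈ = s , u∈ , core∈bags c s

  -- A vertex of K occurs in all bags, which are joined through the centre; any other vertex occurs
  -- in one bag only.
  linked : ∀ v s t → v Subset.∈ bags s → v Subset.∈ bags t →
           Star (λ a b → Adj (starGraph m) a b × v Subset.∈ bags a × v Subset.∈ bags b) s t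
  linked v s t v∈s v∈t with splitAt k v in e
  linked v s t v∈s v∈t | inj₁ c with refl ← splitAt⁻¹-↑ˡ {j = c} e = toCenter s ◅◅ fromCenter t
    where
    R = λ a b → Adj (starGraph m) a b × (c ↑ˡ m) Subset.∈ bags a × (c ↑ˡ m) Subset.∈ bags b
    toCenter : ∀ u → Star R u fzero
    toCenter fzero    = stop
    toCenter (fsuc i) = (adj-center i , core∈bags c (fsuc i) , core∈bags c fzero) ◅ stop
    fromCenter : ∀ v → Star R fzero v
    fromCenter fzero    = stop
    fromCenter (fsuc i) = (center-adj i , core∈bags c fzero , core∈bags c (fsuc i)) ◅ stop
  linked v s t v∈s v∈t | inj₂ i with refl ← splitAt⁻¹-↑ʳ {j = i} e
    with refl ← rest∈bags⁻ i s v∈s | refl ← rest∈bags⁻ i t v∈t = stop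

  decomposition : TreeDecomposition G
  decomposition = record
    { tree = starGraph m ; isTree = starGraph-tree m ; bag = bags
    ; coverVertex = covered ; coverEdge = coveredEdge ; connected = linked }

  -- The element of `Fin m` provides a bag of size `suc k`; the central bag has only `k` elements.
  width : Fin m → TreeDecomposition.Width decomposition k
  width i = (fsuc i , size i) , bound
    where
    size : ∀ i → ∣ bags (fsuc i) ∣ ≡ suc k
    size i = trans (∣++∣ (Subset.⊤ {k}) ⁅ i ⁆)
      (trans (cong₂ _+_ (∣⊤∣≡n k) (∣⁅x⁆∣≡1 i)) (+-comm k 1))
    bound : ∀ s → ∣ bags s ∣ ≤ suc k
    bound fzero    = ≤-trans (≤-reflexive (trans (∣++∣ (Subset.⊤ {k}) (Subset.⊥ {m}))
      (trans (cong₂ _+_ (∣⊤∣≡n k) (∣⊥∣≡0 m)) (+-identityʳ k)))) (n≤1+n k)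
    bound (fsuc i) = ≤-reflexive (size i)

-- `P` will be the existence of a tree decomposition of a given width, for which no decision
-- procedure is at hand; so a minimum is found only up to double negation. If there were none,
-- induction on `b` would exclude every value below `b`, finally `k` itself.
¬¬-least : ∀ {P : ℕ → Set} {k} → P k → ¬ ¬ (∃[ j ] j ≤ k × P j × (∀ i → P i → j ≤ i))
¬¬-least {P} {k} Pk none = below (suc k) ≤-refl k ≤-refl Pk
  where
  below : ∀ b → b ≤ suc k → ∀ j → j < b → ¬ P j
  below (suc b) (s≤s b≤k) j (s≤s j≤b) Pj with m≤n⇒m<n∨m≡n j≤b
  ... | inj₁ j<b  = below b (m≤n⇒m≤1+n b≤k) j j<b Pj
  ... | inj₂ refl = none (b , b≤k , Pj , λ i Pi → ≮⇒≥ λ i<b → below b (m≤n⇒m≤1+n b≤k) i i<b Pi)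

treewidth-≤ : ∀ {n} {G : Graph n} {k} (D : TreeDecomposition G) → TreeDecomposition.Width D k →
              ¬ ¬ (∃[ j ] j ≤ k × Treewidth G j)
treewidth-≤ {G = G} D W none = ¬¬-least {P = λ j → Σ[ D ∈ TreeDecomposition G ] TreeDecomposition.Width D j}
  (D , W) λ (j , j≤k , DW , least) → none (j , j≤k , DW , λ D′ i W′ → least i (D′ , W′))

module GraphTreewidth (Γ : Gadget) {n d : ℕ} (A B : Vec (Vec Bool d) n) where

  open Gadget Γ
  open Construction Γ A B

  core-meets : ∀ u v → (u , v) ∈ edges graph → Σ[ c ∈ Fin (d + 4) ] u ≡ c ↑ˡ (n + n)
  core-meets u v p with ∈-rows⁻ vertices p
  ... | v′ , _ , q with ∈-map⁻ _ q
  ... | u′ , u′∈ , refl = core-index u′ (low-core v′ u′∈)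

  graph-treewidth : Fin n → ¬ ¬ (∃[ k ] k ≤ d + 4 × Treewidth graph k)
  graph-treewidth i = treewidth-≤ decomposition (width (i ↑ˡ n))
    where open StarDecomposition {d + 4} {n + n} graph core-meets

-- Distances

least : ∀ {P : ℕ → Set} → (∀ i → Dec (P i)) → ∀ k → P k →
        ∃[ j ] j ≤ k × P j × (∀ i → P i → j ≤ i)
least P? k Pk with P? 0
least P? k       Pk | yes P0 = 0 , z≤n , P0 , λ _ _ → z≤n
least P? zero    Pk | no ¬P0 = ⊥-elim (¬P0 Pk)
least {P} P? (suc k) Pk | no ¬P0 with least (P? ∘ suc) k Pk
... | j , j≤k , Pj , min = suc j , s≤s j≤k , Pj , min′
  where
  min′ : ∀ i → P i → suc j ≤ i
  min′ zero    Pi = ⊥-elim (¬P0 Pi)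
  min′ (suc i) Pi = s≤s (min i Pi)

module Distances {N : ℕ} (G : Graph N) where

  Within : ℕ → Fin N → Fin N → Set
  Within k u v = Σ[ p ∈ Walk G u v ] walkLength G p ≤ k

  Apart : ℕ → Fin N → Fin N → Set
  Apart k u v = ∀ (p : Walk G u v) → k ≤ walkLength G p

  WalkOfLength : Fin N → Fin N → ℕ → Set
  WalkOfLength u v m = Σ[ p ∈ Walk G u v ] walkLength G p ≡ m

  adj? : ∀ u v → Dec (Adj G u v)
  adj? u v = Any.any? (≡-dec _≟ᶠ_ _≟ᶠ_ (u , v)) (edges G) ⊎-dec
             Any.any? (≡-dec _≟ᶠ_ _≟ᶠ_ (v , u)) (edges G)

  walkOfLength? : ∀ m u v → Dec (WalkOfLength u v m)
  walkOfLength? zero    u v = map′ (λ { refl → stop , refl }) (λ { (stop , _) → refl }) (u ≟ᶠ v)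
  walkOfLength? (suc m) u v =
    map′ (λ (w , uw , p , l) → uw ◅ p , cong suc l)
         (λ { (uw ◅ p , l) → _ , uw , p , suc-injective l })
         (any? (λ w → adj? u w ×-dec walkOfLength? m w v))

  -- `Distance` demands a shortest walk. Walks of a fixed length are decidable, so the least length
  -- can be searched for, up to the length of the given walk.
  distance-≤ : ∀ {k u v} → Within k u v → ∃[ e ] Distance G u v e × e ≤ k
  distance-≤ {u = u} {v} (p , p≤k)
    with least (λ m → walkOfLength? m u v) (walkLength G p) (p , refl)
  ... | e , e≤p , q , min = e , (q , λ p′ → min _ (p′ , refl)) , ≤-trans e≤p p≤k

  distance-≡ : ∀ {k u v} → Within k u v → Apart k u v → Distance G u v k
  distance-≡ (p , p≤k) apart = (p , ≤-antisym p≤k (apart p)) , apart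

  apart-eccentricity : ∀ {k u v e} → Apart k u v → Eccentricity G u e → k ≤ e
  apart-eccentricity {v = v} apart (_ , near) with near v
  ... | _ , ((p , refl) , _) , p≤e = ≤-trans (apart p) p≤e

Common : ∀ {d} → Vec Bool d → Vec Bool d → Set
Common a b = ∃[ j ] j Subset.∈ a × j Subset.∈ b

module Neighbourhoods (Γ : Gadget) {n d : ℕ} (A B : Vec (Vec Bool d) n) where

  open Gadget Γ
  open Construction Γ A B public
  open Distances graph public

  at : Vertex n d → Fin (order n d)
  at = index

  -- A record keeps `u` and `v` visible in the type, so that they can be inferred; behind `index`
  -- they would be hidden.
  record _within_from_ (u : Vertex n d) (k : ℕ) (v : Vertex n d) : Set where
    constructor walk
    field within : Within k (index u) (index v)

  open _within_from_ public

  _apart_from_ : Vertex n d → ℕ → Vertex n d → Set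
  u apart k from v = Apart k (index u) (index v)

  ~-sym : ∀ {u v} → u ~ v → v ~ u
  ~-sym = swap

  within-0 : ∀ {k u} → u within k from u
  within-0 = walk (stop , z≤n)

  within-1 : ∀ {k u v} → u ~ v → u within suc k from v
  within-1 {u = u} {v} uv = walk (~⇒Adj {u} {v} uv ◅ stop , s≤s z≤n)

  within-2 : ∀ {k u v} w → u ~ w → w ~ v → u within suc (suc k) from v
  within-2 {u = u} {v} w uw wv = walk (~⇒Adj {u} {w} uw ◅ ~⇒Adj {w} {v} wv ◅ stop , s≤s (s≤s z≤n))

  within-3 : ∀ {u v} w x → u ~ w → w ~ x → x ~ v → u within 3 from v
  within-3 {u} {v} w x uw wx xv =
    walk (~⇒Adj {u} {w} uw ◅ ~⇒Adj {w} {x} wx ◅ ~⇒Adj {x} {v} xv ◅ stop , ≤-refl)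

  apart-2 : ∀ u v → u ≢ v → ¬ u ~ v → u apart 2 from v
  apart-2 u v u≢v u≁v p = go p refl refl
    where
    go : ∀ {k l} (p : Walk graph k l) → k ≡ index u → l ≡ index v → 2 ≤ walkLength graph p
    go stop             k≡ l≡     = ⊥-elim (u≢v (index-injective {u = u} {v} (trans (sym k≡) l≡)))
    go (a ◅ stop)       refl refl = ⊥-elim (u≁v (Adj⇒~ u v a))
    go (_ ◅ _ ◅ _)   _    _    = s≤s (s≤s z≤n)

  apart-3 : ∀ u v → u ≢ v → ¬ u ~ v → (∀ w → u ~ w → ¬ w ~ v) → u apart 3 from v
  apart-3 u v u≢v u≁v none p = go p refl refl
    where
    go : ∀ {k l} (p : Walk graph k l) → k ≡ index u → l ≡ index v → 3 ≤ walkLength graph p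
    go stop                 k≡ l≡     = ⊥-elim (u≢v (index-injective {u = u} {v} (trans (sym k≡) l≡)))
    go (a ◅ stop)           refl refl = ⊥-elim (u≁v (Adj⇒~ u v a))
    go (_◅_ {j = w} a (b ◅ stop)) refl refl = ⊥-elim (none (vertex {n} {d} w)
      (Adj⇒~ u (vertex {n} {d} w) (subst (Adj graph (index u)) (sym (index-vertex {n} {d} w)) a))
      (Adj⇒~ (vertex {n} {d} w) v (subst (λ k → Adj graph k (index v)) (sym (index-vertex {n} {d} w)) b)))
    go (_ ◅ _ ◅ _ ◅ _)   _    _    = s≤s (s≤s (s≤s z≤n))

  A~0 : ∀ i → vecA i ~ hub (# 0)
  A~0 i = inj₂ (∈-++⁺ʳ (select coord (lookup A i)) (here refl))

  A~2 : ∀ i → vecA i ~ hub (# 2)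
  A~2 i = inj₂ (∈-++⁺ʳ (select coord (lookup A i)) (there (here refl)))

  B~1 : ∀ i → vecB i ~ hub (# 1)
  B~1 i = inj₂ (∈-++⁺ʳ (select coord (lookup B i)) (here refl))

  1~0 : hub (# 1) ~ hub (# 0)
  1~0 = inj₂ (∈-++⁺ʳ coords (here refl))

  coord~0 : ∀ j → coord j ~ hub (# 0)
  coord~0 j = inj₁ (select-∈⁺ coord (Vec.replicate d true) j ∈⊤)

  coord~1 : ∀ j → coord j ~ hub (# 1)
  coord~1 j = inj₁ (∈-++⁺ˡ (select-∈⁺ coord (Vec.replicate d true) j ∈⊤))

  A~coord : ∀ i j → j Subset.∈ lookup A i → vecA i ~ coord j
  A~coord i j j∈ = inj₂ (∈-++⁺ˡ (select-∈⁺ coord (lookup A i) j j∈))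

  B~coord : ∀ i j → j Subset.∈ lookup B i → vecB i ~ coord j
  B~coord i j j∈ = inj₂ (∈-++⁺ˡ (select-∈⁺ coord (lookup B i) j j∈))

  A-neighbours : ∀ i {u} → vecA i ~ u →
                 (∃[ j ] u ≡ coord j × j Subset.∈ lookup A i) ⊎ u ≡ hub (# 0) ⊎ u ≡ hub (# 2)
  A-neighbours i {u} (inj₁ p) = ⊥-elim (low-core u p)
  A-neighbours i (inj₂ p) with mixed-∈⁻ (lookup A i) hubsA p
  ... | inj₁ c                               = inj₁ c
  ... | inj₂ (_ , u≡ , here refl)            = inj₂ (inj₁ u≡)
  ... | inj₂ (_ , u≡ , there (here refl))    = inj₂ (inj₂ u≡)

  B-neighbours : ∀ i {u} → vecB i ~ u →
                 (∃[ j ] u ≡ coord j × j Subset.∈ lookup B i) ⊎ u ≡ hub (# 1)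
  B-neighbours i {u} (inj₁ p) = ⊥-elim (low-core u p)
  B-neighbours i (inj₂ p) with mixed-∈⁻ (lookup B i) hubsB p
  ... | inj₁ c                    = inj₁ c
  ... | inj₂ (_ , u≡ , here refl) = inj₂ u≡

  A≁B : ∀ i j → ¬ vecA i ~ vecB j
  A≁B i j p with A-neighbours i p
  ... | inj₁ (_ , () , _)
  ... | inj₂ (inj₁ ())
  ... | inj₂ (inj₂ ())

  common-within : ∀ i j → Common (lookup A i) (lookup B j) → vecA i within 2 from vecB j
  common-within i j (c , c∈A , c∈B) = within-2 (coord c) (A~coord i c c∈A) (~-sym (B~coord j c c∈B))

  always-within : ∀ i j → vecA i within 3 from vecB j
  always-within i j = within-3 (hub (# 0)) (hub (# 1)) (A~0 i) (~-sym 1~0) (~-sym (B~1 j))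

  -- A vector of A sees, besides coordinates, only hubs 0 and 2, and a vector of B only hub 1; so a
  -- common neighbour has to be a shared coordinate.
  disjoint-apart : ∀ i j → ¬ Common (lookup A i) (lookup B j) → vecA i apart 3 from vecB j
  disjoint-apart i j disj = apart-3 (vecA i) (vecB j) (λ ()) (A≁B i j) none
    where
    none : ∀ w → vecA i ~ w → ¬ w ~ vecB j
    none w aw wb with A-neighbours i aw | B-neighbours j (~-sym wb)
    ... | inj₁ (c , refl , c∈A) | inj₁ (.c , refl , c∈B) = disj (c , c∈A , c∈B)
    ... | inj₁ (_ , refl , _)   | inj₂ ()
    ... | inj₂ (inj₁ refl)      | inj₁ (_ , () , _)
    ... | inj₂ (inj₁ refl)      | inj₂ ()
    ... | inj₂ (inj₂ refl)      | inj₁ (_ , () , _)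
    ... | inj₂ (inj₂ refl)      | inj₂ ()

-- Hub 1 brings hub 2 within distance 2 of the coordinates and of B. Hub 3, joined to hubs 0 and 1,
-- is within distance 2 of everything.
diameterGadget : Gadget
diameterGadget = record
  { l₂ = # 1 ∷ [] ; l₃ = # 0 ∷ # 1 ∷ []
  ; ordered₂ = s≤s (s≤s z≤n) ∷ [] ; ordered₃ = s≤s z≤n ∷ s≤s (s≤s z≤n) ∷ []
  ; unique₂ = [] ∷ [] ; unique₃ = ((λ ()) ∷ []) ∷ [] ∷ [] }

radiusGadget : Gadget
radiusGadget = record
  { l₂ = [] ; l₃ = # 2 ∷ []
  ; ordered₂ = [] ; ordered₃ = s≤s (s≤s (s≤s z≤n)) ∷ []
  ; unique₂ = [] ; unique₃ = [] ∷ [] }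

module DiameterGraph {n d : ℕ} (A B : Vec (Vec Bool d) n) (i₀ : Fin n) where

  open Neighbourhoods diameterGadget A B

  -- Every vertex is near hub 0 or hub 1, and only a vector of A and, on the
  -- other side, a vector of B or hub 2 are not near the same one of them.
  Near : Fin 4 → Vertex n d → Set
  Near h v = v ≡ hub h ⊎ v ~ hub h

  near-within : ∀ h {k u v} → Near h u → Near h v → u within suc (suc k) from v
  near-within h (inj₁ refl) (inj₁ refl) = within-0
  near-within h (inj₁ refl) (inj₂ vh)   = within-1 (~-sym vh)
  near-within h (inj₂ uh)   (inj₁ refl) = within-1 uh
  near-within h (inj₂ uh)   (inj₂ vh)   = within-2 (hub h) uh (~-sym vh)

  -- The diameters 2 and 3 are the cases `k` = 0 and `k` = 1.
  module _ {k : ℕ} (AB : ∀ i j → vecA i within suc (suc k) from vecB j)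
                   (BA : ∀ i j → vecB j within suc (suc k) from vecA i) where

    data Side (v : Vertex n d) : Set where
      both  : Near (# 0) v → Near (# 1) v → Side v
      onlyA : ∀ i → v ≡ vecA i → Near (# 0) v → Side v
      onlyB : (∀ i → vecA i within suc (suc k) from v) → (∀ i → v within suc (suc k) from vecA i) →
              Near (# 1) v → Side v

    side : ∀ v → Side v
    side (coord j)                        = both (inj₂ (coord~0 j)) (inj₂ (coord~1 j))
    side (hub fzero)                      = both (inj₁ refl) (inj₂ (~-sym 1~0))
    side (hub (fsuc fzero))               = both (inj₂ 1~0) (inj₁ refl)
    side (hub (fsuc (fsuc fzero)))        =
      onlyB (λ i → within-1 (A~2 i)) (λ i → within-1 (~-sym (A~2 i))) (inj₂ (inj₂ (here refl)))
    side (hub (fsuc (fsuc (fsuc fzero)))) = both (inj₂ (inj₂ (here refl))) (inj₂ (inj₂ (there (here refl))))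
    side (vecA i)                         = onlyA i refl (inj₂ (A~0 i))
    side (vecB j)                         = onlyB (λ i → AB i j) (λ i → BA i j) (inj₂ (B~1 j))

    all-within : ∀ u v → u within suc (suc k) from v
    all-within u v with side u | side v
    ... | both p q       | both p′ q′       = near-within (# 0) p p′
    ... | both p q       | onlyA _ _ p′     = near-within (# 0) p p′
    ... | both p q       | onlyB _ _ q′     = near-within (# 1) q q′
    ... | onlyA _ _ p    | both p′ q′       = near-within (# 0) p p′
    ... | onlyA _ _ p    | onlyA _ _ p′     = near-within (# 0) p p′
    ... | onlyA i refl p | onlyB from _ _   = from i
    ... | onlyB _ _ q    | both p′ q′       = near-within (# 1) q q′
    ... | onlyB _ to _   | onlyA i refl _   = to i
    ... | onlyB _ _ q    | onlyB _ _ q′     = near-within (# 1) q q′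

    all-distances : ∀ u v → ∃[ e ] Distance graph u v e × e ≤ suc (suc k)
    all-distances u v = distance-≤ (subst₂ (Within (suc (suc k)))
      (index-vertex {n} {d} u) (index-vertex {n} {d} v) (within (all-within (vertex u) (vertex v))))

  diameter-3 : ∀ i j → ¬ Common (lookup A i) (lookup B j) → Diameter graph 3
  diameter-3 i j disj =
    (at (vecA i) , at (vecB j) , distance-≡ (within (always-within i j)) (disjoint-apart i j disj)) ,
    all-distances always-within
      (λ i j → within-3 (hub (# 1)) (hub (# 0)) (B~1 j) 1~0 (~-sym (A~0 i)))

  diameter-2 : (∀ i j → Common (lookup A i) (lookup B j)) → Diameter graph 2
  diameter-2 common =
    -- The diameter must be attained: whatever the vectors are, one of A and hub 1 are at distance
    -- exactly 2, through hub 0.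
    (at (vecA i₀) , at (hub (# 1)) ,
      distance-≡ (within {vecA i₀} {2} {hub (# 1)} (within-2 (hub (# 0)) (A~0 i₀) (~-sym 1~0)))
                 (apart-2 (vecA i₀) (hub (# 1)) (λ ()) A≁1)) ,
    all-distances (λ i j → common-within i j (common i j)) common-within′
    where
    A≁1 : ¬ vecA i₀ ~ hub (# 1)
    A≁1 p with A-neighbours i₀ p
    ... | inj₁ (_ , () , _)
    ... | inj₂ (inj₁ ())
    ... | inj₂ (inj₂ ())
    common-within′ : ∀ i j → vecB j within 2 from vecA i
    common-within′ i j with common i j
    ... | c , c∈A , c∈B = within-2 (coord c) (B~coord j c c∈B) (~-sym (A~coord i c c∈A))

module RadiusGraph {n d : ℕ} (A B : Vec (Vec Bool d) n) (i₀ : Fin n) where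

  open Neighbourhoods radiusGadget A B

  -- Hub 3 is pendant at hub 2, whose other neighbours are the vectors of A:
  -- this keeps all other vertices from having eccentricity 2.
  3-neighbour : ∀ {u} → u ~ hub (# 3) → u ≡ hub (# 2)
  3-neighbour (inj₁ (here refl)) = refl
  3-neighbour {hub fzero} (inj₂ p) with select-∈⁻ coord (Vec.replicate d true) p
  ... | _ , () , _
  3-neighbour {hub (fsuc fzero)} (inj₂ p) with mixed-∈⁻ (Vec.replicate d true) (# 0 ∷ []) p
  ... | inj₁ (_ , () , _)
  ... | inj₂ (_ , () , here refl)
  3-neighbour {hub (fsuc (fsuc (fsuc fzero)))} (inj₂ (here ()))
  3-neighbour {vecA i} (inj₂ p) with mixed-∈⁻ (lookup A i) hubsA p
  ... | inj₁ (_ , () , _)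
  ... | inj₂ (_ , () , here refl)
  ... | inj₂ (_ , () , there (here refl))
  3-neighbour {vecB i} (inj₂ p) with mixed-∈⁻ (lookup B i) hubsB p
  ... | inj₁ (_ , () , _)
  ... | inj₂ (_ , () , here refl)

  2-neighbours : ∀ {u} → u ~ hub (# 2) → u ≡ hub (# 3) ⊎ (∃[ i ] u ≡ vecA i)
  2-neighbours {hub fzero} (inj₂ p) with select-∈⁻ coord (Vec.replicate d true) p
  ... | _ , () , _
  2-neighbours {hub (fsuc fzero)} (inj₂ p) with mixed-∈⁻ (Vec.replicate d true) (# 0 ∷ []) p
  ... | inj₁ (_ , () , _)
  ... | inj₂ (_ , () , here refl)
  2-neighbours {hub (fsuc (fsuc (fsuc fzero)))} p = inj₁ refl
  2-neighbours {vecA i} p = inj₂ (i , refl)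
  2-neighbours {vecB i} (inj₂ p) with mixed-∈⁻ (lookup B i) hubsB p
  ... | inj₁ (_ , () , _)
  ... | inj₂ (_ , () , here refl)

  apart-from-3 : ∀ u → u ≢ hub (# 3) → u ≢ hub (# 2) → (∀ i → u ≢ vecA i) →
                 u apart 3 from hub (# 3)
  apart-from-3 u u≢3 u≢2 u≢A = apart-3 u (hub (# 3)) u≢3 (u≢2 ∘ 3-neighbour) none
    where
    none : ∀ w → u ~ w → ¬ w ~ hub (# 3)
    none w uw w3 with refl ← 3-neighbour w3 with 2-neighbours uw
    ... | inj₁ u≡3       = u≢3 u≡3
    ... | inj₂ (i , u≡A) = u≢A i u≡A

  B≁2 : ∀ j → ¬ vecB j ~ hub (# 2)
  B≁2 j p with 2-neighbours p
  ... | inj₁ ()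
  ... | inj₂ (_ , ())

  B≁3 : ∀ j → ¬ vecB j ~ hub (# 3)
  B≁3 j p with 3-neighbour p
  ... | ()

  -- Hubs 2 and 3 are themselves close to hub 3, so for these two a vector of B is the far vertex.
  3-apart-B : hub (# 3) apart 3 from vecB i₀
  3-apart-B = apart-3 (hub (# 3)) (vecB i₀) (λ ()) (B≁3 i₀ ∘ ~-sym) none
    where
    none : ∀ w → hub (# 3) ~ w → ¬ w ~ vecB i₀
    none w 3w wB with refl ← 3-neighbour (~-sym 3w) = B≁2 i₀ (~-sym wB)

  2-apart-B : hub (# 2) apart 3 from vecB i₀
  2-apart-B = apart-3 (hub (# 2)) (vecB i₀) (λ ()) (B≁2 i₀ ∘ ~-sym) none
    where
    none : ∀ w → hub (# 2) ~ w → ¬ w ~ vecB i₀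
    none w 2w wB with 2-neighbours (~-sym 2w)
    ... | inj₁ refl       = B≁3 i₀ (~-sym wB)
    ... | inj₂ (i , refl) = A≁B i i₀ wB

  A≁3 : ∀ i → ¬ vecA i ~ hub (# 3)
  A≁3 i p with 3-neighbour p
  ... | ()

  A-apart-3 : ∀ i → vecA i apart 2 from hub (# 3)
  A-apart-3 i = apart-2 (vecA i) (hub (# 3)) (λ ()) (A≁3 i)

  A-within-3 : ∀ i → vecA i within 2 from hub (# 3)
  A-within-3 i = within-2 (hub (# 2)) (A~2 i) (inj₁ (here refl))

  A-within : ∀ i {k} → (∀ j → vecA i within suc (suc k) from vecB j) →
             ∀ v → vecA i within suc (suc k) from v
  A-within i AB (coord j)                        = within-2 (hub (# 0)) (A~0 i) (~-sym (coord~0 j))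
  A-within i AB (hub fzero)                      = within-1 (A~0 i)
  A-within i AB (hub (fsuc fzero))               = within-2 (hub (# 0)) (A~0 i) (~-sym 1~0)
  A-within i AB (hub (fsuc (fsuc fzero)))        = within-1 (A~2 i)
  A-within i AB (hub (fsuc (fsuc (fsuc fzero)))) = within-2 (hub (# 2)) (A~2 i) (inj₁ (here refl))
  A-within i AB (vecA j)                         = within-2 (hub (# 0)) (A~0 i) (~-sym (A~0 j))
  A-within i AB (vecB j)                         = AB j

  A-distances : ∀ i {k} → (∀ j → vecA i within suc (suc k) from vecB j) →
                ∀ v → ∃[ e ] Distance graph (at (vecA i)) v e × e ≤ suc (suc k)
  A-distances i AB v = distance-≤ (subst (Within _ (at (vecA i)))
    (index-vertex {n} {d} v) (within (A-within i AB (vertex v))))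

  -- Every vertex outside A has eccentricity at least 3, so for either radius only the vectors of A
  -- remain to be checked.
  radius-≥ : ∀ {m} → m ≤ 3 → (∀ i e → Eccentricity graph (at (vecA i)) e → m ≤ e) →
             ∀ x e → Eccentricity graph x e → m ≤ e
  radius-≥ {m} m≤3 hA x e ecc = go (vertex x)
    (subst (λ x → Eccentricity graph x e) (sym (index-vertex {n} {d} x)) ecc)
    where
    go : ∀ v → Eccentricity graph (index v) e → m ≤ e
    go (vecA i)  ecc = hA i e ecc
    go (coord j) ecc = ≤-trans m≤3 (apart-eccentricity (apart-from-3 (coord j) (λ ()) (λ ()) (λ _ ())) ecc)
    go (hub fzero) ecc =
      ≤-trans m≤3 (apart-eccentricity (apart-from-3 (hub (# 0)) (λ ()) (λ ()) (λ _ ())) ecc)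
    go (hub (fsuc fzero)) ecc =
      ≤-trans m≤3 (apart-eccentricity (apart-from-3 (hub (# 1)) (λ ()) (λ ()) (λ _ ())) ecc)
    go (hub (fsuc (fsuc fzero))) ecc        = ≤-trans m≤3 (apart-eccentricity 2-apart-B ecc)
    go (hub (fsuc (fsuc (fsuc fzero)))) ecc = ≤-trans m≤3 (apart-eccentricity 3-apart-B ecc)
    go (vecB j) ecc = ≤-trans m≤3 (apart-eccentricity (apart-from-3 (vecB j) (λ ()) (λ ()) (λ _ ())) ecc)

  radius-2 : ∀ i → (∀ j → Common (lookup A i) (lookup B j)) → Radius graph 2
  radius-2 i common =
    (at (vecA i) , (at (hub (# 3)) , distance-≡ (within (A-within-3 i)) (A-apart-3 i)) ,
      A-distances i (λ j → common-within i j (common j))) ,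
    radius-≥ (n≤1+n 2) (λ i e → apart-eccentricity (A-apart-3 i))

  radius-3 : (∀ i → ∃[ j ] ¬ Common (lookup A i) (lookup B j)) → Radius graph 3
  radius-3 disj =
    (at (vecA i₀) , (at (vecB j₀) ,
        distance-≡ (within (always-within i₀ j₀)) (disjoint-apart i₀ j₀ (proj₂ (disj i₀)))) ,
      A-distances i₀ (always-within i₀)) ,
    radius-≥ ≤-refl (λ i e → apart-eccentricity (disjoint-apart i _ (proj₂ (disj i))))
    where j₀ = proj₁ (disj i₀)

-- Running times

^-distrib-* : ∀ m n o → (m * n) ^ o ≡ m ^ o * n ^ o
^-distrib-* m n zero    = refl
^-distrib-* m n (suc o) = trans (cong (m * n *_) (^-distrib-* m n o))
  (solve 4 (λ m n a b → m :* n :* (a :* b) := m :* a :* (n :* b)) refl m n (m ^ o) (n ^ o))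

m≤m^n : ∀ m n .{{_ : NonZero n}} → m ≤ m ^ n
m≤m^n zero    n       = z≤n
m≤m^n (suc m) (suc n) = m≤m*n (suc m) (suc m ^ n) {{m^n≢0 (suc m) n}}

n<2^n : ∀ n → n < 2 ^ n
n<2^n zero    = s≤s z≤n
n<2^n (suc n) = +-mono-≤ (m^n>0 2 n) (≤-trans (n<2^n n) (m≤m+n (2 ^ n) 0))

m≤2*⌈m/2⌉ : ∀ m → m ≤ 2 * ⌈ m /2⌉
m≤2*⌈m/2⌉ m = ≤-trans (≤-reflexive (sym (⌊n/2⌋+⌈n/2⌉≡n m)))
  (+-mono-≤ (⌊n/2⌋≤⌈n/2⌉ m) (≤-reflexive (sym (+-identityʳ ⌈ m /2⌉))))

n≤2^⌈log₂n⌉ : ∀ n → n ≤ 2 ^ ⌈log₂ n ⌉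
n≤2^⌈log₂n⌉ n = go n n ≤-refl
  where
  go : ∀ fuel n → n ≤ fuel → n ≤ 2 ^ ⌈log₂ n ⌉
  go _          zero             _         = z≤n
  go _          (suc zero)       _         = s≤s z≤n
  go (suc fuel) n@(suc (suc n′)) (s≤s n≤f) = begin
    n                          ≤⟨ m≤2*⌈m/2⌉ n ⟩
    2 * ⌈ n /2⌉
      ≤⟨ *-monoʳ-≤ 2 (go fuel ⌈ n /2⌉ (≤-trans (≤-pred (⌈n/2⌉<n n′)) n≤f)) ⟩
    2 ^ suc ⌈log₂ ⌈ n /2⌉ ⌉     ≡⟨ cong (λ l → 2 ^ suc l) (⌈log₂⌈n/2⌉⌉≡⌈log₂n⌉∸1 n) ⟩
    2 ^ suc (⌈log₂ n ⌉ ∸ 1)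
      ≡⟨ cong (2 ^_) (m+[n∸m]≡n {1} (⌈log₂⌉-mono-≤ {2} {n} (s≤s (s≤s z≤n)))) ⟩
    2 ^ ⌈log₂ n ⌉ ∎
    where open ≤-Reasoning

2^⌈log₂n⌉≤2n : ∀ n .{{_ : NonZero n}} → 2 ^ ⌈log₂ n ⌉ ≤ 2 * n
2^⌈log₂n⌉≤2n n = ≮⇒≥ λ 2n<2^L → 1+n≰n (begin
  suc ⌈log₂ n ⌉             ≡⟨ sym (⌈log₂2*n⌉≡1+⌈log₂n⌉ n) ⟩
  ⌈log₂ (2 * n) ⌉           ≤⟨ ⌈log₂⌉-mono-≤ (<⇒≤ 2n<2^L) ⟩
  ⌈log₂ (2 ^ ⌈log₂ n ⌉) ⌉   ≡⟨ ⌈log₂2^n⌉≡n ⌈log₂ n ⌉ ⟩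
  ⌈log₂ n ⌉ ∎)
  where open ≤-Reasoning

-- With n the logarithm of the input size, this makes the square of the dimension at most linear in
-- that size.
[1+n]²≤4*2^n : ∀ n → suc n * suc n ≤ 4 * 2 ^ n
[1+n]²≤4*2^n zero    = s≤s z≤n
[1+n]²≤4*2^n (suc n) = begin
  suc (suc n) * suc (suc n)
    ≡⟨ solve 1 (λ n → (con 2 :+ n) :* (con 2 :+ n)
       := (con 1 :+ n) :* (con 1 :+ n) :+ (con 3 :+ con 2 :* n)) refl n ⟩
  suc n * suc n + (3 + 2 * n)         ≤⟨ +-mono-≤ ([1+n]²≤4*2^n n) (begin
    3 + 2 * n                           ≤⟨ m≤m+n _ (1 + 2 * n) ⟩
    3 + 2 * n + (1 + 2 * n)
      ≡⟨ solve 1 (λ n → con 3 :+ con 2 :* n :+ (con 1 :+ con 2 :* n)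
         := con 4 :* (con 1 :+ n)) refl n ⟩
    4 * suc n                           ≤⟨ *-monoʳ-≤ 4 (n<2^n n) ⟩
    4 * 2 ^ n                           ∎) ⟩
  4 * 2 ^ n + 4 * 2 ^ n
    ≡⟨ solve 1 (λ x → con 4 :* x :+ con 4 :* x := con 4 :* (con 2 :* x)) refl (2 ^ n) ⟩
  4 * (2 * 2 ^ n)                     ∎
  where open ≤-Reasoning

-- With ε replaced by 1 / e, the time bound is t ^ e * n ≤ K ^ e * n ^ (2 * e).

-- A sum is at most twice its larger term.
sum-bound : ∀ e {a b X Y n M} → a ^ e * n ≤ X ^ e * M → b ^ e * n ≤ Y ^ e * M →
            (a + b) ^ e * n ≤ (2 * (X + Y)) ^ e * M
sum-bound e {a} {b} {X} {Y} {n} {M} ha hb with ≤-total a b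
... | inj₁ a≤b = begin
  (a + b) ^ e * n           ≤⟨ *-monoˡ-≤ n (^-monoˡ-≤ e (+-mono-≤ a≤b (m≤m+n b 0))) ⟩
  (2 * b) ^ e * n           ≡⟨ cong (_* n) (^-distrib-* 2 b e) ⟩
  2 ^ e * b ^ e * n         ≡⟨ *-assoc (2 ^ e) (b ^ e) n ⟩
  2 ^ e * (b ^ e * n)       ≤⟨ *-monoʳ-≤ (2 ^ e) hb ⟩
  2 ^ e * (Y ^ e * M)       ≡⟨ sym (*-assoc (2 ^ e) (Y ^ e) M) ⟩
  2 ^ e * Y ^ e * M         ≡⟨ cong (_* M) (sym (^-distrib-* 2 Y e)) ⟩
  (2 * Y) ^ e * M           ≤⟨ *-monoˡ-≤ M (^-monoˡ-≤ e (*-monoʳ-≤ 2 (m≤n+m Y X))) ⟩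
  (2 * (X + Y)) ^ e * M     ∎
  where open ≤-Reasoning
... | inj₂ b≤a = begin
  (a + b) ^ e * n           ≤⟨ *-monoˡ-≤ n (^-monoˡ-≤ e (+-monoʳ-≤ a (≤-trans b≤a (m≤m+n a 0)))) ⟩
  (2 * a) ^ e * n           ≡⟨ cong (_* n) (^-distrib-* 2 a e) ⟩
  2 ^ e * a ^ e * n         ≡⟨ *-assoc (2 ^ e) (a ^ e) n ⟩
  2 ^ e * (a ^ e * n)       ≤⟨ *-monoʳ-≤ (2 ^ e) ha ⟩
  2 ^ e * (X ^ e * M)       ≡⟨ sym (*-assoc (2 ^ e) (X ^ e) M) ⟩
  2 ^ e * X ^ e * M         ≡⟨ cong (_* M) (sym (^-distrib-* 2 X e)) ⟩
  (2 * X) ^ e * M           ≤⟨ *-monoˡ-≤ M (^-monoˡ-≤ e (*-monoʳ-≤ 2 (m≤m+n X Y))) ⟩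
  (2 * (X + Y)) ^ e * M     ∎
  where open ≤-Reasoning

^-double : ∀ x q → x ^ (q + q) ≡ x ^ q * x ^ q
^-double x q = ^-distribˡ-+-* x q q

^-square : ∀ x e → x ^ (2 * e) ≡ (x * x) ^ e
^-square x e = trans (cong (λ k → x ^ (e + k)) (+-identityʳ e))
  (trans (^-double x e) (sym (^-distrib-* x x e)))

-- Squaring the bound turns N ^ p into at least n ^ 2; one factor n absorbs X.
transfer-bound : ∀ q p {t N n C X D E} .{{_ : NonZero q}} .{{_ : NonZero p}} .{{_ : NonZero n}} →
  n ≤ N → N ≤ D * n → X ^ (q + q) ≤ E * n → t ^ q * N ^ p ≤ (C * X) ^ q * N ^ (2 * q) →
  t ^ (q + q) * n ≤ (C * E * (D * D)) ^ (q + q) * n ^ (2 * (q + q))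
transfer-bound q@(suc q′) p {t} {N} {n} {C} {X} {D} {E} n≤N N≤Dn X≤ h =
  *-cancelʳ-≤ _ _ n (begin
    t ^ e * n * n                                 ≡⟨ *-assoc (t ^ e) n n ⟩
    t ^ e * (n * n)                               ≤⟨ *-monoʳ-≤ (t ^ e) (*-mono-≤ n≤N n≤N) ⟩
    t ^ e * (N * N)                               ≡⟨ cong (_* (N * N)) (^-double t q) ⟩
    t ^ q * t ^ q * (N * N)
      ≡⟨ solve 2 (λ a b → a :* a :* (b :* b) := a :* b :* (a :* b)) refl (t ^ q) N ⟩
    t ^ q * N * (t ^ q * N)                       ≤⟨ *-mono-≤ h′ h′ ⟩
    Z * Y * (Z * Y)
      ≡⟨ solve 2 (λ a b → a :* b :* (a :* b) := a :* a :* (b :* b)) refl Z Y ⟩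
    Z * Z * (Y * Y)
      ≡⟨ cong₂ _*_ (sym (^-double (C * X) q)) (sym (^-distribˡ-+-* N (2 * q) (2 * q))) ⟩
    (C * X) ^ e * N ^ (2 * q + 2 * q)
      ≡⟨ cong ((C * X) ^ e *_) (cong (N ^_) (sym (*-distribˡ-+ 2 q q))) ⟩
    (C * X) ^ e * N ^ (2 * e)                     ≤⟨ *-mono-≤ CX≤ N≤ ⟩
    (C ^ e * (E ^ e * n)) * ((D * D) ^ e * n ^ (2 * e))
      ≡⟨ solve 5 (λ c e n d m → c :* (e :* n) :* (d :* m)
         := c :* e :* d :* m :* n) refl (C ^ e) (E ^ e) n ((D * D) ^ e) (n ^ (2 * e)) ⟩
    C ^ e * E ^ e * (D * D) ^ e * n ^ (2 * e) * n
      ≡⟨ cong (λ x → x * n ^ (2 * e) * n) (sym CEDD≡) ⟩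
    (C * E * (D * D)) ^ e * n ^ (2 * e) * n       ∎)
  where
  open ≤-Reasoning
  e = q + q
  Z = (C * X) ^ q
  Y = N ^ (2 * q)
  instance
    N≢0 : NonZero N
    N≢0 = >-nonZero (≤-trans (>-nonZero⁻¹ n) n≤N)
  CEDD≡ : (C * E * (D * D)) ^ e ≡ C ^ e * E ^ e * (D * D) ^ e
  CEDD≡ = trans (^-distrib-* (C * E) (D * D) e) (cong (_* (D * D) ^ e) (^-distrib-* C E e))
  h′ : t ^ q * N ≤ Z * Y
  h′ = ≤-trans (*-monoʳ-≤ (t ^ q) (m≤m^n N p)) h
  CX≤ : (C * X) ^ e ≤ C ^ e * (E ^ e * n)
  CX≤ = ≤-trans (≤-reflexive (^-distrib-* C X e))
    (*-monoʳ-≤ (C ^ e) (≤-trans X≤ (*-monoˡ-≤ n (m≤m^n E e))))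
  N≤ : N ^ (2 * e) ≤ (D * D) ^ e * n ^ (2 * e)
  N≤ = ≤-trans (^-monoˡ-≤ (2 * e) N≤Dn)
    (≤-reflexive (trans (^-distrib-* D n (2 * e)) (cong (_* n ^ (2 * e)) (^-square D e))))

-- Here `s` is 1 + d, and s² = O(n) makes the building time O(n^(3/2)). Then T^(2q) n is of order
-- n^(3q+1), and 3q + 1 ≤ 4q.
build-bound : ∀ q {T K n s J} .{{_ : NonZero q}} .{{_ : NonZero n}} → T ≤ K * (n * s) → s * s ≤ J * n →
  T ^ (q + q) * n ≤ (K * K * J) ^ (q + q) * n ^ (2 * (q + q))
build-bound q@(suc q′) {T} {K} {n} {s} {J} T≤ s²≤ = begin
  T ^ (q + q) * n
    ≡⟨ cong (_* n) (trans (^-double T q) (sym (^-distrib-* T T q))) ⟩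
  (T * T) ^ q * n                                 ≤⟨ *-monoˡ-≤ n (^-monoˡ-≤ q T²≤) ⟩
  (K * K * J * (n * n * n)) ^ q * n
    ≡⟨ cong (_* n) (^-distrib-* (K * K * J) (n * n * n) q) ⟩
  (K * K * J) ^ q * (n * n * n) ^ q * n           ≡⟨ *-assoc ((K * K * J) ^ q) _ n ⟩
  (K * K * J) ^ q * ((n * n * n) ^ q * n)         ≤⟨ *-mono-≤ K≤ n≤ ⟩
  (K * K * J) ^ (q + q) * n ^ (2 * (q + q))       ∎
  where
  open ≤-Reasoning
  T²≤ : T * T ≤ K * K * J * (n * n * n)
  T²≤ = begin
    T * T                          ≤⟨ *-mono-≤ T≤ T≤ ⟩
    K * (n * s) * (K * (n * s))
      ≡⟨ solve 3 (λ k n s → k :* (n :* s) :* (k :* (n :* s))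
         := k :* k :* (n :* n) :* (s :* s)) refl K n s ⟩
    K * K * (n * n) * (s * s)      ≤⟨ *-monoʳ-≤ (K * K * (n * n)) s²≤ ⟩
    K * K * (n * n) * (J * n)
      ≡⟨ solve 3 (λ k n j → k :* k :* (n :* n) :* (j :* n)
         := k :* k :* j :* (n :* n :* n)) refl K n J ⟩
    K * K * J * (n * n * n)        ∎
  K≤ : (K * K * J) ^ q ≤ (K * K * J) ^ (q + q)
  K≤ with K * K * J
  ... | zero  = z≤n
  ... | suc k = ^-monoʳ-≤ (suc k) (m≤m+n q q)
  n≤ : (n * n * n) ^ q * n ≤ n ^ (2 * (q + q))
  n≤ = begin
    (n * n * n) ^ q * n            ≤⟨ *-monoʳ-≤ ((n * n * n) ^ q) (m≤m^n n q) ⟩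
    (n * n * n) ^ q * n ^ q        ≡⟨ sym (^-distrib-* (n * n * n) n q) ⟩
    (n * n * n * n) ^ q            ≡⟨ cong (_^ q) (*-assoc (n * n) n n) ⟩
    (n * n * (n * n)) ^ q          ≡⟨ ^-distrib-* (n * n) (n * n) q ⟩
    (n * n) ^ q * (n * n) ^ q      ≡⟨ sym (^-double (n * n) q) ⟩
    (n * n) ^ (q + q)              ≡⟨ sym (^-square n (q + q)) ⟩
    n ^ (2 * (q + q))              ∎

timeConstant : (K J C E D : ℕ) → ℕ
timeConstant K J C E D = 2 * (K * K * J + C * E * (D * D))

total-bound : ∀ q p {t u N n C X D E A B K s J} .{{_ : NonZero q}} .{{_ : NonZero p}} .{{_ : NonZero n}} →
  n ≤ N → N ≤ D * n → X ^ (q + q) ≤ E * n → t ^ q * N ^ p ≤ (C * X) ^ q * N ^ (2 * q) →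
  A + B + 3 ≤ K * (n * s) → s * s ≤ J * n → u ≤ B + (t + 2) →
  u ^ (q + q) * n ^ 1 ≤ timeConstant K J C E D ^ (q + q) * n ^ (2 * (q + q))
total-bound q p {t} {u} {N} {n} {C} {X} {D} {E} {A} {B} {K} {s} {J} n≤N N≤Dn X≤ t≤ A+B≤ s²≤ u≤ = begin
  u ^ (q + q) * n ^ 1            ≡⟨ cong (u ^ (q + q) *_) (^-identityʳ n) ⟩
  u ^ (q + q) * n                ≤⟨ *-monoˡ-≤ n (^-monoˡ-≤ (q + q) (≤-trans u≤ (≤-reflexive
                                      (trans (cong (B +_) (+-comm t 2)) (sym (+-assoc B 2 t)))))) ⟩
  (B + 2 + t) ^ (q + q) * n      ≤⟨ sum-bound (q + q) (build-bound q {B + 2} {K} {n} {s} {J} B≤ s²≤)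
                                      (transfer-bound q p {t} {N} {n} {C} {X} {D} {E} n≤N N≤Dn X≤ t≤) ⟩
  timeConstant K J C E D ^ (q + q) * n ^ (2 * (q + q)) ∎
  where
  open ≤-Reasoning
  B≤ : B + 2 ≤ K * (n * s)
  B≤ = ≤-trans (+-mono-≤ (m≤n+m B A) (n≤1+n 2)) A+B≤

-- A crude common bound for the values of `f` below the threshold from which the little-o estimate
-- holds.
sumBelow : (ℕ → ℕ) → ℕ → ℕ
sumBelow f zero    = 0
sumBelow f (suc k) = f k + sumBelow f k

≤-sumBelow : ∀ f {k m} → k < m → f k ≤ sumBelow f m
≤-sumBelow f {k} {suc m} (s≤s k≤m) with m≤n⇒m<n∨m≡n k≤m
... | inj₁ k<m  = ≤-trans (≤-sumBelow f k<m) (m≤n+m _ (f m))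
... | inj₂ refl = m≤m+n (f k) _

-- Little-o is applied with m = c e: for large k it gives c e f(k) ≤ k ≤ c log n + 4, and dividing
-- by c leaves e f(k) ≤ log n + 4, whose power of 2 is linear in n.
subpolynomial : ∀ f → LittleO f → ∀ e c .{{_ : NonZero c}} → ∃[ E ]
  (∀ n .{{_ : NonZero n}} k → k ≤ c * ⌈log₂ n ⌉ + 4 → (2 ^ f k) ^ e ≤ E * n)
subpolynomial f f=o e c with f=o (c * e)
-- The first factor covers all k below `k₀`. For the others, 32 is 2^4, from the four hubs, times
-- the 2 lost by rounding the logarithm up.
... | k₀ , small = 2 ^ (F * e) * 32 , bound
  where
  open ≤-Reasoning
  F = sumBelow f k₀
  bound : ∀ n .{{_ : NonZero n}} k → k ≤ c * ⌈log₂ n ⌉ + 4 → (2 ^ f k) ^ e ≤ 2 ^ (F * e) * 32 * n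
  bound n k k≤ with k₀ ≤? k
  ... | no k₀≰k = begin
    (2 ^ f k) ^ e           ≡⟨ ^-*-assoc 2 (f k) e ⟩
    2 ^ (f k * e)           ≤⟨ ^-monoʳ-≤ 2 (*-monoˡ-≤ e (≤-sumBelow f (≰⇒> k₀≰k))) ⟩
    2 ^ (F * e)             ≤⟨ m≤m*n _ 32 ⟩
    2 ^ (F * e) * 32        ≤⟨ m≤m*n _ n ⟩
    2 ^ (F * e) * 32 * n    ∎
  ... | yes k₀≤k = begin
    (2 ^ f k) ^ e             ≡⟨ ^-*-assoc 2 (f k) e ⟩
    2 ^ (f k * e)             ≤⟨ ^-monoʳ-≤ 2 fe≤ ⟩
    2 ^ (⌈log₂ n ⌉ + 4)       ≡⟨ ^-distribˡ-+-* 2 ⌈log₂ n ⌉ 4 ⟩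
    2 ^ ⌈log₂ n ⌉ * 16        ≤⟨ *-monoˡ-≤ 16 (2^⌈log₂n⌉≤2n n) ⟩
    2 * n * 16
      ≡⟨ solve 1 (λ n → con 2 :* n :* con 16 := con 1 :* con 32 :* n) refl n ⟩
    1 * 32 * n                ≤⟨ *-monoˡ-≤ n (*-monoˡ-≤ 32 (m^n>0 2 (F * e))) ⟩
    2 ^ (F * e) * 32 * n      ∎
    where
    fe≤ : f k * e ≤ ⌈log₂ n ⌉ + 4
    fe≤ = *-cancelˡ-≤ c (begin
      c * (f k * e)             ≡⟨ solve 3 (λ c f e → c :* (f :* e) := c :* e :* f) refl c (f k) e ⟩
      c * e * f k               ≤⟨ small k k₀≤k ⟩
      k                         ≤⟨ k≤ ⟩
      c * ⌈log₂ n ⌉ + 4         ≤⟨ +-monoʳ-≤ (c * ⌈log₂ n ⌉) (m≤n*m 4 c) ⟩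
      c * ⌈log₂ n ⌉ + c * 4     ≡⟨ sym (*-distribˡ-+ c ⌈log₂ n ⌉ 4) ⟩
      c * (⌈log₂ n ⌉ + 4)       ∎)

-- Sizes of the graph, its words and the values in the machine

module Sizes (c n : ℕ) .{{_ : NonZero n}} where

  open ≤-Reasoning

  L d : ℕ
  L = ⌈log₂ n ⌉
  d = c * L

  L≤2n : L ≤ 2 * n
  L≤2n = ≤-trans (<⇒≤ (n<2^n L)) (2^⌈log₂n⌉≤2n n)

  order-≤ : d + 4 + (n + n) ≤ (2 * c + 6) * n
  order-≤ = begin
    d + 4 + (n + n)
      ≤⟨ +-monoˡ-≤ (n + n) (+-mono-≤ (*-monoʳ-≤ c L≤2n) (m≤m*n 4 n)) ⟩
    c * (2 * n) + 4 * n + (n + n)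
      ≡⟨ solve 2 (λ c n → c :* (con 2 :* n) :+ con 4 :* n :+ (n :+ n)
         := (con 2 :* c :+ con 6) :* n) refl c n ⟩
    (2 * c + 6) * n                  ∎

  n≤order : n ≤ d + 4 + (n + n)
  n≤order = ≤-trans (m≤m+n n n) (m≤n+m (n + n) (d + 4))

  -- The graph has O(n) vertices, so its word length exceeds that of the vectors by a constant
  -- factor at most, which a larger κ makes up for.
  word-≤ : suc ⌈log₂ (d + 4 + (n + n)) ⌉ ≤ (2 * c + 7) * suc L
  word-≤ = begin
    suc ⌈log₂ (d + 4 + (n + n)) ⌉       ≤⟨ s≤s (⌈log₂⌉-mono-≤ order≤2^) ⟩
    suc ⌈log₂ (2 ^ (2 * c + 6 + L)) ⌉   ≡⟨ cong suc (⌈log₂2^n⌉≡n (2 * c + 6 + L)) ⟩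
    suc (2 * c + 6 + L)                 ≤⟨ m≤m+n _ ((2 * c + 6) * L) ⟩
    suc (2 * c + 6 + L) + (2 * c + 6) * L
      ≡⟨ solve 2 (λ c l → con 1 :+ (con 2 :* c :+ con 6 :+ l) :+ (con 2 :* c :+ con 6) :* l
         := (con 2 :* c :+ con 7) :* (con 1 :+ l)) refl c L ⟩
    (2 * c + 7) * suc L                 ∎
    where
    order≤2^ : d + 4 + (n + n) ≤ 2 ^ (2 * c + 6 + L)
    order≤2^ = begin
      d + 4 + (n + n)            ≤⟨ order-≤ ⟩
      (2 * c + 6) * n            ≤⟨ *-mono-≤ (<⇒≤ (n<2^n (2 * c + 6))) (n≤2^⌈log₂n⌉ n) ⟩
      2 ^ (2 * c + 6) * 2 ^ L    ≡⟨ sym (^-distribˡ-+-* 2 (2 * c + 6) L) ⟩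
      2 ^ (2 * c + 6 + L)        ∎

  [1+d]≤ : suc d ≤ suc c * suc L
  [1+d]≤ = begin
    suc d                      ≤⟨ m≤m+n (suc d) (c + L) ⟩
    suc d + (c + L)
      ≡⟨ solve 2 (λ c l → con 1 :+ c :* l :+ (c :+ l) := (con 1 :+ c) :* (con 1 :+ l)) refl c L ⟩
    suc c * suc L              ∎

  [1+d]²≤ : suc d * suc d ≤ (suc c * suc c * 8) * n
  [1+d]²≤ = begin
    suc d * suc d                             ≤⟨ *-mono-≤ [1+d]≤ [1+d]≤ ⟩
    suc c * suc L * (suc c * suc L)
      ≡⟨ solve 2 (λ c l → c :* l :* (c :* l) := c :* c :* (l :* l)) refl (suc c) (suc L) ⟩
    suc c * suc c * (suc L * suc L)           ≤⟨ *-monoʳ-≤ (suc c * suc c) ([1+n]²≤4*2^n L) ⟩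
    suc c * suc c * (4 * 2 ^ L)
      ≤⟨ *-monoʳ-≤ (suc c * suc c) (*-monoʳ-≤ 4 (2^⌈log₂n⌉≤2n n)) ⟩
    suc c * suc c * (4 * (2 * n))
      ≡⟨ solve 2 (λ a n → a :* (con 4 :* (con 2 :* n)) := a :* con 8 :* n) refl (suc c * suc c) n ⟩
    suc c * suc c * 8 * n                     ∎

  -- Each factor is bounded by a power of 2: K < 2^K, n ≤ 2^L and 1 + d ≤ 2^c 2^L. The exponents add
  -- up to at most a constant times 1 + L.
  fits : ∀ K → K * (n * suc d) < 2 ^ ((K + c + 3) * suc L)
  fits K = begin-strict
    K * (n * suc d)
      ≤⟨ *-monoʳ-≤ K (*-mono-≤ (n≤2^⌈log₂n⌉ n) (≤-trans [1+d]≤ (*-mono-≤ (n<2^n c) (n<2^n L)))) ⟩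
    K * (2 ^ L * (2 ^ c * 2 ^ L))
      <⟨ *-monoˡ-< (2 ^ L * (2 ^ c * 2 ^ L)) {{nz}} (n<2^n K) ⟩
    2 ^ K * (2 ^ L * (2 ^ c * 2 ^ L))
      ≡⟨ cong (λ x → 2 ^ K * (2 ^ L * x)) (sym (^-distribˡ-+-* 2 c L)) ⟩
    2 ^ K * (2 ^ L * 2 ^ (c + L))
      ≡⟨ cong (2 ^ K *_) (sym (^-distribˡ-+-* 2 L (c + L))) ⟩
    2 ^ K * 2 ^ (L + (c + L))
      ≡⟨ sym (^-distribˡ-+-* 2 K (L + (c + L))) ⟩
    2 ^ (K + (L + (c + L)))
      ≤⟨ ^-monoʳ-≤ 2 (m≤m+n (K + (L + (c + L))) (3 + (K + c + 1) * L)) ⟩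
    2 ^ (K + (L + (c + L)) + (3 + (K + c + 1) * L))
      ≡⟨ cong (2 ^_) (solve 3 (λ k c l → k :+ (l :+ (c :+ l)) :+ (con 3 :+ (k :+ c :+ con 1) :* l)
           := (k :+ c :+ con 3) :* (con 1 :+ l)) refl K c L) ⟩
    2 ^ ((K + c + 3) * suc L)                   ∎
    where
    nz : NonZero (2 ^ L * (2 ^ c * 2 ^ L))
    nz = m*n≢0 (2 ^ L) (2 ^ c * 2 ^ L) {{m^n≢0 2 L}}
      {{m*n≢0 (2 ^ c) (2 ^ L) {{m^n≢0 2 c}} {{m^n≢0 2 L}}}}

-- The reduction

-- On answers 0 and 1, b = 1 is the identity and b = 0 the negation.
compareWith : ℕ → Program
compareWith b = set 1 b ∷ op eq 0 0 1 ∷ []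

bit-≤1 : ∀ b → bit b ≤ 1
bit-≤1 true  = ≤-refl
bit-≤1 false = z≤n

compareWith-run : ∀ w b → b ≤ 1 → 1 < 2 ^ w → ∀ σ →
  ∃[ τ ] run w 2 (compareWith b , σ) ≡ just ([] , τ) × reg τ 0 ≡ bit (reg σ 0 ≡ᵇ b)
compareWith-run w b b≤1 1<2^w σ
  rewrite <⇒<ᵇ≡true (≤-<-trans b≤1 1<2^w)
        | <⇒<ᵇ≡true (≤-<-trans (bit-≤1 (reg σ 0 ≡ᵇ b)) 1<2^w) = _ , refl , refl

outputs? : ∀ w p xs t v → Dec (Outputs w p xs t v)
outputs? w p xs t v with run w t (p , initial xs)
... | nothing          = no λ { (_ , () , _) }
... | just (_ ∷ _ , _) = no λ { (_ , () , _) }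
... | just ([] , σ)    = map′ (λ r≡v → σ , refl , r≡v) (λ { (_ , refl , r≡v) → r≡v }) (reg σ 0 ≟ v)

-- This is a = O(X) with the constant as an index, so that the constant is assembled along the shape
-- of the cost expression.
record Linear (X a k : ℕ) : Set where
  constructor linear
  field linear-≤ : a ≤ k * X

open Linear

linear-+ : ∀ {X a b x y} → Linear X a x → Linear X b y → Linear X (a + b) (x + y)
linear-+ {X} {x = x} {y} (linear a≤) (linear b≤) =
  linear (≤-trans (+-mono-≤ a≤ b≤) (≤-reflexive (sym (*-distribʳ-+ X x y))))

linear-suc : ∀ {X a x} .{{_ : NonZero X}} → Linear X a x → Linear X (suc a) (suc x)
linear-suc {X} (linear a≤) = linear (+-mono-≤ (>-nonZero⁻¹ X) a≤)

linear-*ˡ : ∀ {X a x} c → Linear X a x → Linear X (c * a) (c * x)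
linear-*ˡ {X} {a} {x} c (linear a≤) =
  linear (≤-trans (*-monoʳ-≤ c a≤) (≤-reflexive (sym (*-assoc c x X))))

linear-*ʳ : ∀ {X a x} c → Linear X a x → Linear X (a * c) (x * c)
linear-*ʳ {X} {a} {x} c h =
  subst₂ (Linear X) (*-comm c a) (*-comm c x) (linear-*ˡ c h)

linear-factor : ∀ {s m k} n → Linear s m k → Linear (n * s) (n * m) k
linear-factor {s} {m} {k} n (linear m≤) = linear (≤-trans (*-monoʳ-≤ n m≤)
  (≤-reflexive (trans (sym (*-assoc n k s)) (trans (cong (_* s) (*-comm n k)) (*-assoc k n s)))))

linear-const : ∀ X .{{_ : NonZero X}} k → Linear X k k
linear-const X k = linear (m≤m*n k X)

linear-refl : ∀ {X a} → a ≤ X → Linear X a 1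
linear-refl {X} a≤ = linear (≤-trans a≤ (m≤m+n X 0))

-- It mirrors the expression for `writtenCost`, each term replaced by its constant relative to n (1
-- + d); `x` and `y` stand for the lengths of `l₂` and `l₃`.
writtenConstant : ℕ → ℕ → ℕ
writtenConstant x y = 19 + 3 * 1 + ((1 * 8 + 4 + 0) + ((1 * 8 + 4 + 5) + (((x * 5) + 1) + (((y * 5) + 1) +
  (suc (suc (1 * 12 + 6 + 10)) + suc (suc (1 * 12 + 6 + 5)))))))

module _ (x y n d : ℕ) .{{_ : NonZero n}} where

  private
    X : ℕ
    X = n * suc d

    instance
      X≢0 : NonZero X
      X≢0 = m*n≢0 n (suc d)

    constant : ∀ k → Linear X k k
    constant = linear-const X

    nd≤ : Linear X (n * d) 1
    nd≤ = linear-refl (*-monoʳ-≤ n (n≤1+n d))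

    d≤ : Linear X d 1
    d≤ = linear-refl (≤-trans (n≤1+n d) (m≤n*m (suc d) n))

    rows≤ : ∀ k → Linear X (n * (d * 12 + 6 + k)) (1 * 12 + 6 + k)
    rows≤ k = linear-factor n (linear-+ (linear-+ (linear-*ʳ 12 (linear-refl (n≤1+n d)))
      (linear-const (suc d) 6)) (linear-const (suc d) k))

  input-linear : Linear X (1 + n + d) 3
  input-linear = linear-+ (linear-suc (linear-refl (m≤m*n n (suc d)))) d≤

  written-linear : Linear X
    (19 + 3 * (n * d) + ((d * 8 + 4 + 0) + ((d * 8 + 4 + 5) + ((x * 5 + 1) + ((y * 5 + 1) +
      ((1 + suc (n * (d * 12 + 6 + 10))) + (1 + suc (n * (d * 12 + 6 + 5)))))))))
    (writtenConstant x y)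
  written-linear =
    linear-+ (linear-+ (constant 19) (linear-*ˡ 3 nd≤))
    (linear-+ (linear-+ (linear-+ (linear-*ʳ 8 d≤) (constant 4)) (constant 0))
    (linear-+ (linear-+ (linear-+ (linear-*ʳ 8 d≤) (constant 4)) (constant 5))
    (linear-+ (linear-+ (constant (x * 5)) (constant 1))
    (linear-+ (linear-+ (constant (y * 5)) (constant 1))
    (linear-+ (linear-suc (linear-suc (rows≤ 10))) (linear-suc (linear-suc (rows≤ 5))))))))

  total-linear : ∀ {s w i k} → Linear X s i → Linear X w k →
    Linear X (s + (w + (18 + 3 * (n * d) + (s + w) * 7)) + 3)
             (i + (k + (18 + 3 * 1 + (i + k) * 7)) + 3)
  total-linear s≤ w≤ = linear-+ (linear-+ s≤ (linear-+ w≤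
    (linear-+ (linear-+ (constant 18) (linear-*ˡ 3 nd≤)) (linear-*ʳ 7 (linear-+ s≤ w≤)))))
    (constant 3)

-- The first 3 bounds the values 1 + n + d of the input. The last is slack for the two steps of
-- `compareWith` and for words that can hold 1.
totalConstant : Gadget → ℕ
totalConstant Γ = 3 + (k + (18 + 3 * 1 + (3 + k) * 7)) + 3
  where
  k = writtenConstant (length (Gadget.l₂ Γ)) (length (Gadget.l₃ Γ))

totalCost-linear : ∀ (Γ : Gadget) {n d} (A B : Vec (Vec Bool d) n) .{{_ : NonZero n}} →
  Linear (n * suc d) (1 + n + d + Build.totalCost (Gadget.l₂ Γ) (Gadget.l₃ Γ) A B + 3)
         (totalConstant Γ)
totalCost-linear Γ {n} {d} A B =
  total-linear x y n d (input-linear x y n d) (written-linear x y n d)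
  where
  x = length (Gadget.l₂ Γ)
  y = length (Gadget.l₃ Γ)

-- Opaque, as conversion checking would otherwise unfold powers with this
-- constant in the exponent.
opaque
  unfolding Build.buildCost

  buildConstant : Gadget → ℕ
  buildConstant = totalConstant

  buildCost-≤ : ∀ (Γ : Gadget) {n d} (A B : Vec (Vec Bool d) n) .{{_ : NonZero n}} →
    1 + n + d + Build.buildCost (Gadget.l₂ Γ) (Gadget.l₃ Γ) A B + 3 ≤ buildConstant Γ * (n * suc d)
  buildCost-≤ Γ A B = Linear.linear-≤ (totalCost-linear Γ A B)

-- Building ends in a state pointwise equal to `initial ys`, so `run-sim` replays the run of `p`
-- there, with longer words and the comparison as its continuation.
reduce : ∀ {q xs ys B c} → Exec q (noRegs , xs) c (noRegs , ys) → Bounded B (noRegs , xs) →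
  ∀ p b {w w′ t v} → b ≤ 1 → w′ ≤ w → B + c + 3 < 2 ^ w → Outputs w′ p ys t v →
  ∃[ s ] s ≤ c + (t + 2) × Outputs w (q ++ (p ++ compareWith b)) xs s (bit (v ≡ᵇ b))
reduce {xs = xs} {ys} {B} build bounded-xs p b {w} {w′} {t} b≤1 w′≤w fits (σ , eqσ , refl)
  with runs build w B bounded-xs (≤-<-trans (m≤m+n _ 3) fits) (initial xs) (p ++ compareWith b)
         (pointwise (λ r → sym (noRegs≈0 r)) (λ _ → refl))
... | t₁ , σ₁ , t₁≤ , σ₁≈ , eq₁
  with run-sim {w = w′} {w} t {p} {initial ys} {σ₁} (compareWith b) w′≤w
         (≈-sym (≈-trans σ₁≈ (pointwise noRegs≈0 (λ _ → refl)))) eqσ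
... | t₂ , σ₂ , t₂≤ , σ≈σ₂ , eq₂
  with compareWith-run w b b≤1 (≤-<-trans (≤-trans (s≤s z≤n) (m≤n+m 3 _)) fits) σ₂
... | σ₃ , eq₃ , r₃ = t₁ + (t₂ + 2) , +-mono-≤ t₁≤ (+-monoˡ-≤ 2 t₂≤) , σ₃ ,
  trans (run-+ w t₁ eq₁) (trans (run-+ w t₂ eq₂) eq₃) ,
  trans r₃ (cong (λ v → bit (v ≡ᵇ b)) (sym (reg≈ σ≈σ₂ 0)))

firstIndex : ∀ n .{{_ : NonZero n}} → Fin n
firstIndex (suc n) = fzero

numerator-nonZero : ∀ ε → Positive ε → NonZero (abs (↥ ε))
numerator-nonZero (mkℚ (ℤ.+ suc _) _ _) _ = _

-- 1 / 2q for the denominator q of ε, which is at most ε / 2.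
halfUnit : ℚ → ℚ
halfUnit ε = mkℚ (ℤ.+ 1) (ℚ.denominator-1 ε + ↧ₙ ε) (1-coprimeTo _)

module Reduction (Γ : Gadget) (b : ℕ) (b≤1 : b ≤ 1) (ε : ℚ) (pos : Positive ε)
  (f : ℕ → ℕ) (f=o : LittleO f) (C : ℕ) (p : Program) (κ c : ℕ) (1≤c : 1 ≤ c) where

  open Gadget Γ

  q e : ℕ
  q = ↧ₙ ε
  e = q + q

  instance
    c≢0 : NonZero c
    c≢0 = >-nonZero 1≤c
    num≢0 : NonZero (abs (↥ ε))
    num≢0 = numerator-nonZero ε pos

  -- `D` bounds the number of vertices relative to n, `E` absorbs 2^f(k), and `K₀` is the constant
  -- of the building cost. `κ′` is a sum since words must suffice both for `p` on the graph and for
  -- building it.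
  K₀ E D K κ′ : ℕ
  E = proj₁ (subpolynomial f f=o e c)
  D = 2 * c + 6
  K₀ = buildConstant Γ
  K = timeConstant K₀ (suc c * suc c * 8) C E D
  κ′ = κ * (2 * c + 7) + (K₀ + c + 3)

  reduction : Program
  reduction = ((prologue ++ writeEdges l₂ l₃) ++ epilogue) ++ (p ++ compareWith b)

  module _ (I : TwoLists c) where

    open TwoLists I
    open Construction Γ A B using (graph; encode-graph)
    open GraphTreewidth Γ A B using (graph-treewidth)
    open Build l₂ l₃ A B using (buildCost; build-ok; input-bounded)
    open Sizes c n using (order-≤; n≤order; word-≤; [1+d]²≤; fits)

    w w′ : ℕ
    w  = κ′ * suc ⌈log₂ n ⌉
    w′ = κ * suc ⌈log₂ order n d ⌉

    Solution : ℕ → ℕ → Set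
    Solution v t = t ≤ K · n ^[2- halfUnit ε ] × Outputs w reduction (encodeTwoLists I) t v

    -- The search is finite because the time bound limits `t` itself: t ≤ t^e n.
    solution? : ∀ v → Dec (∃[ t ] Solution v t)
    solution? v = map′ (λ (t , _ , s) → t , s) (λ (t , s) → t , s≤s (t≤limit t (proj₁ s)) , s)
      (anyUpTo? (λ t → (_ ≤? _) ×-dec outputs? w reduction (encodeTwoLists I) t v) (suc limit))
      where
      limit = K ^ e * n ^ (2 * e)
      t≤limit : ∀ t → t ^ e * n ^ 1 ≤ limit → t ≤ limit
      t≤limit t = ≤-trans (≤-trans (m≤m^n t e) (m≤m*n (t ^ e) (n ^ 1) {{m^n≢0 n 1}}))

    w′≤w : w′ ≤ w
    w′≤w = begin
      κ * suc ⌈log₂ order n d ⌉                ≤⟨ *-monoʳ-≤ κ word-≤ ⟩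
      κ * ((2 * c + 7) * suc ⌈log₂ n ⌉)        ≡⟨ sym (*-assoc κ (2 * c + 7) _) ⟩
      κ * (2 * c + 7) * suc ⌈log₂ n ⌉
        ≤⟨ *-monoˡ-≤ (suc ⌈log₂ n ⌉) (m≤m+n (κ * (2 * c + 7)) (K₀ + c + 3)) ⟩
      κ′ * suc ⌈log₂ n ⌉                       ∎
      where open ≤-Reasoning

    build-fits : 1 + n + d + buildCost + 3 < 2 ^ w
    build-fits = ≤-<-trans (buildCost-≤ Γ A B) (<-≤-trans (fits K₀) (^-monoʳ-≤ 2 exponent≤w))
      where
      exponent≤w : (K₀ + c + 3) * suc ⌈log₂ n ⌉ ≤ w
      exponent≤w = *-monoˡ-≤ (suc ⌈log₂ n ⌉) (m≤n+m (K₀ + c + 3) (κ * (2 * c + 7)))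

    -- The exact treewidth exists only up to double negation, but a running time
    -- within the bound can be searched for.
    solve-for : ∀ v →
      (∀ k → Treewidth graph k →
        ∃[ t ] t ≤ C * 2 ^ f k · order n d ^[2- ε ] × Outputs w′ p (encodeGraph graph) t v) →
      ∃[ t ] Solution (bit (v ≡ᵇ b)) t
    solve-for v solver = decidable-stable (solution? _) λ none →
      graph-treewidth (firstIndex n) λ (k , k≤ , tw) → none (solution k k≤ tw)
      where
      solution : ∀ k → k ≤ d + 4 → Treewidth graph k → ∃[ t ] Solution (bit (v ≡ᵇ b)) t
      solution k k≤ tw =
        let t , t≤ , out = solver k tw
            s , s≤ , out′ = reduce build-ok input-bounded p b b≤1 w′≤w build-fits
              (subst (λ xs → Outputs w′ p xs t v) encode-graph out)
        in s , total-bound q (abs (↥ ε)) {t} {s} {order n d} {n} {C} {2 ^ f k} {D} {E}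
                 {1 + n + d} {buildCost} {K₀} {suc d} {suc c * suc c * 8}
                 n≤order order-≤ (proj₂ (subpolynomial f f=o e c) n k k≤) t≤
                 (buildCost-≤ Γ A B) [1+d]²≤ s≤ ,
           out′

-- Orthogonality and hitting in terms of common coordinates

any-lookup : ∀ {X : Set} {P : X → Set} {n} {xs : Vec X n} → VecAny.Any P xs → ∃[ i ] P (lookup xs i)
any-lookup (here px) = fzero , px
any-lookup (there a) with any-lookup a
... | i , px = fsuc i , px

lookup-any : ∀ {X : Set} {P : X → Set} {n} (xs : Vec X n) i → P (lookup xs i) → VecAny.Any P xs
lookup-any (x ∷ xs) fzero    px = here px
lookup-any (x ∷ xs) (fsuc i) px = there (lookup-any xs i px)

orthogonal⇒¬common : ∀ {d} (a b : Vec Bool d) → Orthogonal a b → ¬ Common a b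
orthogonal⇒¬common (true ∷ a) (true ∷ b) () _
orthogonal⇒¬common (x ∷ a) (y ∷ b) orth (fsuc j , Vec.there p , Vec.there q) =
  orthogonal⇒¬common a b (m+n≡0⇒n≡0 (bit x * bit y) orth) (j , p , q)

¬orthogonal⇒common : ∀ {d} (a b : Vec Bool d) → ¬ Orthogonal a b → Common a b
¬orthogonal⇒common []          []          ¬orth = ⊥-elim (¬orth refl)
¬orthogonal⇒common (true ∷ a)  (true ∷ b)  ¬orth = fzero , Vec.here , Vec.here
¬orthogonal⇒common (true ∷ a)  (false ∷ b) ¬orth with ¬orthogonal⇒common a b ¬orth
... | j , p , q = fsuc j , Vec.there p , Vec.there q
¬orthogonal⇒common (false ∷ a) (y ∷ b)     ¬orth with ¬orthogonal⇒common a b ¬orth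
... | j , p , q = fsuc j , Vec.there p , Vec.there q

common? : ∀ {d} (a b : Vec Bool d) → Dec (Common a b)
common? a b = map′ (λ (j , p) → j , x∈p∩q⁻ a b p) (λ (j , p) → j , x∈p∩q⁺ p) (nonempty? (a ∩ b))

theorem1p7 :
    ((Σ[ ε ∈ ℚ ] Positive ε × Distinguishable2vs3 Diameter ε) → ¬ OVConjecture)
    × ((Σ[ ε ∈ ℚ ] Positive ε × Distinguishable2vs3 Radius ε) → ¬ HSConjecture)
theorem1p7 =
  (λ (ε , pos , f , f=o , C , p , κ , solves) ov → ov (halfUnit ε , _ , λ c 1≤c →
    -- An orthogonal pair means diameter 3, the answer 1 of the given program, so the answer is
    -- kept.
    let open Reduction diameterGadget 1 ≤-refl ε pos f f=o C p κ c 1≤c in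
    K , reduction , κ′ , λ I → let open TwoLists I in
      (λ orth → let i , orthᵢ = any-lookup orth
                    j , orthᵢⱼ = any-lookup orthᵢ in
        solve-for I 1 λ k tw → proj₁ (solves (record { treewidth = tw }))
          (DiameterGraph.diameter-3 A B (firstIndex n) i j (orthogonal⇒¬common _ _ orthᵢⱼ))) ,
      (λ ¬orth → solve-for I 0 λ k tw → proj₂ (solves (record { treewidth = tw }))
          (DiameterGraph.diameter-2 A B (firstIndex n) λ i j → ¬orthogonal⇒common _ _ λ orth →
            ¬orth (lookup-any A i (lookup-any B j orth)))))) ,
  (λ (ε , pos , f , f=o , C , p , κ , solves) hs → hs (halfUnit ε , _ , λ c 1≤c →
    -- A hitting set means radius 2, the answer 0 of the given program, so the answer has to be
    -- negated.
    let open Reduction radiusGadget 0 z≤n ε pos f f=o C p κ c 1≤c in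
    K , reduction , κ′ , λ I → let open TwoLists I in
      (λ hit → let i , hitᵢ = any-lookup hit in
        solve-for I 0 λ k tw → proj₂ (solves (record { treewidth = tw }))
          (RadiusGraph.radius-2 A B (firstIndex n) i λ j →
            let x , x∈ = VecAll.lookup⁺ hitᵢ j in x , x∈p∩q⁻ _ _ x∈)) ,
      (λ ¬hit → solve-for I 1 λ k tw → proj₁ (solves (record { treewidth = tw }))
          (RadiusGraph.radius-3 A B (firstIndex n) λ i →
            -- Disjointness is decidable, so a set of A that is not a hitting set comes with a
            -- definite set of B that it misses.
            ¬∀⟶∃¬ n _ (λ j → common? (lookup A i) (lookup B j)) λ common →
              ¬hit (lookup-any A i (VecAll.lookup⁻ λ j →
                let x , x∈ = common j in x , x∈p∩q⁺ x∈))))))
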